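{- There exist absolute constants $C>0$ and $c>0$ such that the following holds. Let $\epsilon \in (0,1)$, let $n$ be an even positive integer, and let $\mathcal{A} \subset {[n] \choose n/2}$ with $\mathcal{A} \neq \emptyset$ and $\mathcal{A} \neq {[n] \choose n/2}$. Suppose further that $$n \geq \frac{C}{\epsilon^2}\left(\log(1/\epsilon)+\log\left(\frac{1}{\mu(\mathcal{A})(1-\mu(\mathcal{A}))}\right)\right).$$ Then, for $r = \lceil \epsilon \sqrt{n} \rceil$, we have $$\mu\left(\partial^{+r}(\mathcal{A})\cap\partial^{+r}(\mathcal{A}^c)\right) \geq c\,\frac{\epsilon^2}{\log \left(\frac{1}{\epsilon\, \mu(\mathcal{A})(1-\mu(\mathcal{A}))}\right)}\,\mu(\mathcal{A})(1-\mu(\mathcal{A})).$$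
   Context: $[n]=\{1,\dots,n\}$ and ${[n] \choose k}$ denotes the set of $k$-element subsets of $[n]$. For $\mathcal{F} \subset {[n] \choose k}$, $\mu(\mathcal{F}) = |\mathcal{F}|/{n \choose k}$ is the uniform measure on the layer ${[n] \choose k}$. $\mathcal{A}^c = {[n] \choose n/2}\setminus \mathcal{A}$. For $\mathcal{A} \subset {[n] \choose k}$ and $r \leq n-k$, the $r$-th iterated upper shadow is $\partial^{+r}(\mathcal{A}) = \{B \in {[n] \choose k+r}: B \supset A \text{ for some } A \in \mathcal{A}\}$; so here $\partial^{+r}(\mathcal{A})\cap\partial^{+r}(\mathcal{A}^c) \subset {[n] \choose n/2+r}$ and $\mu$ of it is taken in that layer. -}

module Defs where

open import Level using (0ℓ)
open import Data.Empty using (⊥; ⊥-elim)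
open import Data.Product using (∃; _×_; _,_; proj₁; proj₂)
open import Data.Sum using (inj₁; inj₂)
open import Data.Nat using (ℕ; zero; suc; z≤n; s≤s)
import Data.Nat as ℕ
import Data.Nat.Properties as ℕₚ
open import Data.Nat.Combinatorics using (_C_; nCk+nC[k+1]≡[n+1]C[k+1])
open import Data.Integer using (ℤ; +_; +[1+_]; -[1+_])
import Data.Integer as ℤ
import Data.Integer.Properties as ℤₚ
open import Data.Rational using (ℚ; mkℚ; 0ℚ; 1ℚ; ½)
import Data.Rational as ℚ
import Data.Rational.Properties as ℚₚ
import Data.Rational.Unnormalised as ℚᵘ
import Data.Rational.Unnormalised.Properties as ℚᵘₚ
open import Data.Fin.Subset using (Subset; inside; outside; ∣_∣)
  renaming (_⊆_ to _⊆ˢ_)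
open import Data.Fin.Subset.Properties using (anySubset?; _⊆?_)
open import Data.Vec using ([]; _∷_)
open import Data.List using (List; map; filter; length; _++_)
  renaming ([] to []ˡ; _∷_ to _∷ˡ_)
import Data.List.Properties as Listₚ
open import Data.List.Membership.Propositional using () renaming (_∈_ to _∈ˡ_)
open import Data.List.Membership.Propositional.Properties
  using (∈-map⁺; ∈-++⁺ˡ; ∈-++⁺ʳ)
open import Data.List.Relation.Unary.Any using (here; there)
open import Function using (_∘_; _⇔_; mk⇔)
open import Relation.Nullary using (¬_; yes; no)
open import Relation.Nullary.Decidable using (_×-dec_; ¬?)
open import Relation.Unary using (Pred; Decidable)
open import Relation.Binary.PropositionalEquality
  using (_≡_; refl; sym; trans; cong; cong₂; subst; subst₂; module ≡-Reasoning)

infix 8 _⁻¹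

-- Total reciprocal on ℚ, with 0 ⁻¹ = 0.
_⁻¹ : ℚ → ℚ
mkℚ (+ 0)      _ _ ⁻¹ = 0ℚ
p@(mkℚ +[1+ _ ] _ _) ⁻¹ = ℚ.1/ p
p@(mkℚ -[1+ _ ] _ _) ⁻¹ = ℚ.1/ p

-- leftSum k a b is the left-endpoint Riemann sum of ∫ₐᵇ dt/t for the
-- partition of [a , b] into 2ᵏ intervals of equal length.
leftSum : ℕ → ℚ → ℚ → ℚ
leftSum zero    a b = (b ℚ.- a) ℚ.* a ⁻¹
leftSum (suc k) a b = leftSum k a mid ℚ.+ leftSum k mid b
  where mid = (a ℚ.+ b) ℚ.* ½

-- ⌊√n⌋
isqrt : ℕ → ℕ
isqrt zero    = 0
isqrt (suc n) with isqrt n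
... | s with suc s ℕ.* suc s ℕ.≤? suc n
...   | yes _ = suc s
...   | no  _ = s

-- ⌊(k+1)√n⌋ / (k+1)
sqrtApprox : ℕ → ℕ → ℚ
sqrtApprox n k = + isqrt (n ℕ.* (suc k ℕ.* suc k)) ℚ./ suc k

IsCauchy : (ℕ → ℚ) → Set
IsCauchy x = ∀ e → 0ℚ ℚ.< e →
  ∃ λ N → ∀ m n → N ℕ.≤ m → N ℕ.≤ n → ℚ.∣ x m ℚ.- x n ∣ ℚ.≤ e

module Auxiliary where
  open import Data.Rational renaming (∣_∣ to abs)
  open import Data.Rational.Properties
  open import Data.Rational.Solver
  open +-*-Solver
    using (solve; _:=_; _:+_; _:*_; _:-_; :-_; con)

  *-mono-≤ : ∀ {a b c d} → 0ℚ ≤ a → a ≤ b → 0ℚ ≤ c → c ≤ d → a * c ≤ b * d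
  *-mono-≤ {a} {b} {c} {d} 0≤a a≤b 0≤c c≤d = ≤-trans
    (*-monoʳ-≤-nonNeg c {{nonNegative 0≤c}} a≤b)
    (*-monoˡ-≤-nonNeg b {{nonNegative (≤-trans 0≤a a≤b)}} c≤d)

  *-pos : ∀ {a b} → 0ℚ < a → 0ℚ < b → 0ℚ < a * b
  *-pos {a} {b} 0<a 0<b =
    positive⁻¹ _ {{pos*pos⇒pos a {{positive 0<a}} b {{positive 0<b}}}}

  *-nonNeg : ∀ {a b} → 0ℚ ≤ a → 0ℚ ≤ b → 0ℚ ≤ a * b
  *-nonNeg {a} {b} 0≤a 0≤b = subst (_≤ a * b) (*-zeroˡ 0ℚ)
    (*-mono-≤ ≤-refl 0≤a ≤-refl 0≤b)

  +-pos : ∀ {a b} → 0ℚ < a → 0ℚ < b → 0ℚ < a + b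
  +-pos {a} {b} 0<a 0<b =
    positive⁻¹ _ {{pos+pos⇒pos a {{positive 0<a}} b {{positive 0<b}}}}

  0<1 : 0ℚ < 1ℚ
  0<1 = positive⁻¹ 1ℚ

  0<½ : 0ℚ < ½
  0<½ = positive⁻¹ ½

  p<q⇒0<q-p : ∀ {p q} → p < q → 0ℚ < q - p
  p<q⇒0<q-p {p} {q} p<q = subst (_< q - p) (+-inverseʳ p) (+-monoˡ-< (- p) p<q)

  p≤q⇒0≤q-p : ∀ {p q} → p ≤ q → 0ℚ ≤ q - p
  p≤q⇒0≤q-p {p} {q} p≤q = subst (_≤ q - p) (+-inverseʳ p) (+-monoˡ-≤ (- p) p≤q)

  0≤q-p⇒p≤q : ∀ {p q} → 0ℚ ≤ q - p → p ≤ q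
  0≤q-p⇒p≤q {p} {q} h = subst₂ _≤_ (+-identityˡ p)
    (solve 2 (λ p q → (q :- p) :+ p := q) refl p q) (+-monoˡ-≤ p h)

  p+q≤r⇒p≤r-q : ∀ {p q r} → p + q ≤ r → p ≤ r - q
  p+q≤r⇒p≤r-q {p} {q} h = subst (_≤ _)
    (solve 2 (λ p q → (p :+ q) :- q := p) refl p q) (+-monoˡ-≤ (- q) h)

  p-q≤r⇒p≤r+q : ∀ {p q r} → p - q ≤ r → p ≤ r + q
  p-q≤r⇒p≤r+q {p} {q} h = subst (_≤ _)
    (solve 2 (λ p q → (p :- q) :+ q := p) refl p q) (+-monoˡ-≤ q h)

  ≤abs : ∀ p → p ≤ abs p
  ≤abs p with ≤-total 0ℚ p
  ... | inj₁ 0≤p = ≤-reflexive (sym (0≤p⇒∣p∣≡p 0≤p))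
  ... | inj₂ p≤0 = ≤-trans p≤0 (0≤∣p∣ p)

  abs≤ : ∀ {p b} → p ≤ b → - p ≤ b → abs p ≤ b
  abs≤ {p} {b} h₁ h₂ with ∣p∣≡p∨∣p∣≡-p p
  ... | inj₁ eq = subst (_≤ b) (sym eq) h₁
  ... | inj₂ eq = subst (_≤ b) (sym eq) h₂

  abs-swap : ∀ p q → abs (p - q) ≡ abs (q - p)
  abs-swap p q = trans (sym (∣-p∣≡∣p∣ (p - q)))
    (cong abs (solve 2 (λ p q → :- (p :- q) := q :- p) refl p q))

  abs-triangle : ∀ a b c → abs (a - c) ≤ abs (a - b) + abs (b - c)
  abs-triangle a b c = subst (λ t → abs t ≤ abs (a - b) + abs (b - c))
    (solve 3 (λ a b c → (a :- b) :+ (b :- c) := a :- c) refl a b c)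
    (∣p+q∣≤∣p∣+∣q∣ (a - b) (b - c))

  ⁻¹-inverseʳ : ∀ {p} → 0ℚ < p → p * p ⁻¹ ≡ 1ℚ
  ⁻¹-inverseʳ {mkℚ +[1+ n ] d c} _ = *-inverseʳ (mkℚ +[1+ n ] d c)
  ⁻¹-inverseʳ {mkℚ (+ 0) d c} 0<p with positive 0<p
  ... | ()
  ⁻¹-inverseʳ {mkℚ -[1+ n ] d c} 0<p with positive 0<p
  ... | ()

  ⁻¹-pos : ∀ {p} → 0ℚ < p → 0ℚ < p ⁻¹
  ⁻¹-pos {p@(mkℚ +[1+ n ] d c)} _ = positive⁻¹ (1/ p) {{1/pos⇒pos p}}
  ⁻¹-pos {mkℚ (+ 0) d c} 0<p with positive 0<p
  ... | ()
  ⁻¹-pos {mkℚ -[1+ n ] d c} 0<p with positive 0<p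
  ... | ()

  ⁻¹-diff : ∀ {p q} → 0ℚ < p → 0ℚ < q → p ⁻¹ - q ⁻¹ ≡ (q - p) * (p ⁻¹ * q ⁻¹)
  ⁻¹-diff {p} {q} 0<p 0<q = begin
    p ⁻¹ - q ⁻¹
      ≡⟨ cong₂ _-_ (sym (*-identityˡ (p ⁻¹))) (sym (*-identityˡ (q ⁻¹))) ⟩
    1ℚ * p ⁻¹ - 1ℚ * q ⁻¹
      ≡⟨ cong₂ (λ s t → s * p ⁻¹ - t * q ⁻¹)
           (sym (⁻¹-inverseʳ 0<q)) (sym (⁻¹-inverseʳ 0<p)) ⟩
    (q * q ⁻¹) * p ⁻¹ - (p * p ⁻¹) * q ⁻¹
      ≡⟨ solve 4 (λ p q pi qi → (q :* qi) :* pi :- (p :* pi) :* qi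
                              := (q :- p) :* (pi :* qi)) refl p q (p ⁻¹) (q ⁻¹) ⟩
    (q - p) * (p ⁻¹ * q ⁻¹) ∎
    where open ≡-Reasoning

  ⁻¹-anti : ∀ {p q} → 0ℚ < p → p ≤ q → q ⁻¹ ≤ p ⁻¹
  ⁻¹-anti {p} {q} 0<p p≤q = 0≤q-p⇒p≤q (subst (0ℚ ≤_) (sym (⁻¹-diff 0<p 0<q))
    (*-nonNeg (p≤q⇒0≤q-p p≤q)
      (*-nonNeg (<⇒≤ (⁻¹-pos 0<p)) (<⇒≤ (⁻¹-pos 0<q)))))
    where 0<q = <-≤-trans 0<p p≤q

  rescale : ∀ {K e} → 0ℚ < K → K * (e * K ⁻¹) ≡ e
  rescale {K} {e} 0<K = begin
    K * (e * K ⁻¹) ≡⟨ solve 3 (λ K e i → K :* (e :* i) := e :* (K :* i))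
                        refl K e (K ⁻¹) ⟩
    e * (K * K ⁻¹) ≡⟨ cong (e *_) (⁻¹-inverseʳ 0<K) ⟩
    e * 1ℚ         ≡⟨ *-identityʳ e ⟩
    e ∎
    where open ≡-Reasoning

  cauchy-upTo : ∀ x K → 0ℚ < K →
    (∀ e → 0ℚ < e → ∃ λ N → ∀ m n → N ℕ.≤ m → N ℕ.≤ n → abs (x m - x n) ≤ K * e) →
    IsCauchy x
  cauchy-upTo x K 0<K h e 0<e with h (e * K ⁻¹) (*-pos 0<e (⁻¹-pos 0<K))
  ... | N , H = N , λ m n N≤m N≤n → ≤-trans (H m n N≤m N≤n) (≤-reflexive (rescale 0<K))

  const-cauchy : ∀ p → IsCauchy (λ _ → p)
  const-cauchy p e 0<e = 0 , λ _ _ _ _ →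
    subst (_≤ e) (sym (cong abs (+-inverseʳ p))) (<⇒≤ 0<e)

  Bounded : (ℕ → ℚ) → Set
  Bounded x = ∃ λ B → ∃ λ N → 0ℚ < B × (∀ n → N ℕ.≤ n → abs (x n) ≤ B)

  bounded : ∀ {x} → IsCauchy x → Bounded x
  bounded {x} cx with cx 1ℚ 0<1
  ... | N , H = 1ℚ + abs (x N) , N
    , <-≤-trans 0<1 (subst (_≤ 1ℚ + abs (x N)) (+-identityʳ 1ℚ)
        (+-monoʳ-≤ 1ℚ (0≤∣p∣ (x N))))
    , λ n N≤n → ≤-trans
        (subst (λ t → abs t ≤ abs (x n - x N) + abs (x N))
          (solve 2 (λ a b → (a :- b) :+ b := a) refl (x n) (x N))
          (∣p+q∣≤∣p∣+∣q∣ (x n - x N) (x N)))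
        (+-monoˡ-≤ (abs (x N)) (H n N N≤n ℕₚ.≤-refl))

  +-cauchy : ∀ {x y} → IsCauchy x → IsCauchy y → IsCauchy (λ n → x n + y n)
  +-cauchy {x} {y} cx cy = cauchy-upTo (λ n → x n + y n) (1ℚ + 1ℚ) (+-pos 0<1 0<1) λ e 0<e →
    let N₁ , H₁ = cx e 0<e
        N₂ , H₂ = cy e 0<e
    in N₁ ℕ.⊔ N₂ , λ m n N≤m N≤n →
      subst₂ (λ s t → abs s ≤ t)
        (solve 4 (λ a b c d → (a :- c) :+ (b :- d) := (a :+ b) :- (c :+ d))
          refl (x m) (y m) (x n) (y n))
        (solve 1 (λ e → e :+ e := (con 1ℚ :+ con 1ℚ) :* e) refl e)
        (≤-trans (∣p+q∣≤∣p∣+∣q∣ (x m - x n) (y m - y n))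
          (+-mono-≤ (H₁ m n (ℕₚ.m⊔n≤o⇒m≤o N₁ N₂ N≤m) (ℕₚ.m⊔n≤o⇒m≤o N₁ N₂ N≤n))
                    (H₂ m n (ℕₚ.m⊔n≤o⇒n≤o N₁ N₂ N≤m) (ℕₚ.m⊔n≤o⇒n≤o N₁ N₂ N≤n))))

  neg-cauchy : ∀ {x} → IsCauchy x → IsCauchy (λ n → - x n)
  neg-cauchy {x} cx e 0<e with cx e 0<e
  ... | N , H = N , λ m n N≤m N≤n →
    subst (λ t → abs t ≤ e)
      (solve 2 (λ a b → b :- a := :- a :- :- b) refl (x m) (x n))
      (H n m N≤n N≤m)

  prod-diff : ∀ a b c d {e A B} → 0ℚ ≤ e → abs a ≤ A → abs d ≤ B →
    abs (a - c) ≤ e → abs (b - d) ≤ e → abs (a * b - c * d) ≤ (A + B) * e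
  prod-diff a b c d {e} {A} {B} 0≤e a≤A d≤B h₁ h₂ =
    subst₂ (λ s t → abs s ≤ t)
      (solve 4 (λ a b c d → a :* (b :- d) :+ d :* (a :- c) := a :* b :- c :* d)
        refl a b c d)
      (sym (*-distribʳ-+ e A B))
      (≤-trans (∣p+q∣≤∣p∣+∣q∣ (a * (b - d)) (d * (a - c)))
        (+-mono-≤
          (subst (_≤ A * e) (sym (∣p*q∣≡∣p∣*∣q∣ a (b - d)))
            (*-mono-≤ (0≤∣p∣ a) a≤A (0≤∣p∣ (b - d)) h₂))
          (subst (_≤ B * e) (sym (∣p*q∣≡∣p∣*∣q∣ d (a - c)))
            (*-mono-≤ (0≤∣p∣ d) d≤B (0≤∣p∣ (a - c)) h₁))))

  *-cauchy : ∀ {x y} → IsCauchy x → IsCauchy y → IsCauchy (λ n → x n * y n)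
  *-cauchy {x} {y} cx cy =
    let A , Nx , 0<A , Hx = bounded cx
        B , Ny , 0<B , Hy = bounded cy
    in cauchy-upTo (λ n → x n * y n) (A + B) (+-pos 0<A 0<B) λ e 0<e →
    let N₁ , H₁ = cx e 0<e
        N₂ , H₂ = cy e 0<e
    in (N₁ ℕ.⊔ N₂) ℕ.⊔ (Nx ℕ.⊔ Ny) , λ m n N≤m N≤n →
    let m₁ = ℕₚ.m⊔n≤o⇒m≤o (N₁ ℕ.⊔ N₂) (Nx ℕ.⊔ Ny) N≤m
        m₂ = ℕₚ.m⊔n≤o⇒n≤o (N₁ ℕ.⊔ N₂) (Nx ℕ.⊔ Ny) N≤m
        n₁ = ℕₚ.m⊔n≤o⇒m≤o (N₁ ℕ.⊔ N₂) (Nx ℕ.⊔ Ny) N≤n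
        n₂ = ℕₚ.m⊔n≤o⇒n≤o (N₁ ℕ.⊔ N₂) (Nx ℕ.⊔ Ny) N≤n
    in prod-diff (x m) (y m) (x n) (y n) (<⇒≤ 0<e)
         (Hx m (ℕₚ.m⊔n≤o⇒m≤o Nx Ny m₂)) (Hy n (ℕₚ.m⊔n≤o⇒n≤o Nx Ny n₂))
         (H₁ m n (ℕₚ.m⊔n≤o⇒m≤o N₁ N₂ m₁) (ℕₚ.m⊔n≤o⇒m≤o N₁ N₂ n₁))
         (H₂ m n (ℕₚ.m⊔n≤o⇒n≤o N₁ N₂ m₁) (ℕₚ.m⊔n≤o⇒n≤o N₁ N₂ n₁))

  EventuallyAbove : ℚ → (ℕ → ℚ) → Set
  EventuallyAbove d x = ∃ λ N → ∀ n → N ℕ.≤ n → d ≤ x n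

  ⁻¹-diff≤ : ∀ {d p q e} → 0ℚ < d → d ≤ p → d ≤ q → abs (p - q) ≤ e →
    abs (p ⁻¹ - q ⁻¹) ≤ (d ⁻¹ * d ⁻¹) * e
  ⁻¹-diff≤ {d} {p} {q} {e} 0<d d≤p d≤q h = begin
    abs (p ⁻¹ - q ⁻¹)                  ≡⟨ cong abs (⁻¹-diff 0<p 0<q) ⟩
    abs ((q - p) * (p ⁻¹ * q ⁻¹))      ≡⟨ ∣p*q∣≡∣p∣*∣q∣ (q - p) (p ⁻¹ * q ⁻¹) ⟩
    abs (q - p) * abs (p ⁻¹ * q ⁻¹)    ≡⟨ cong₂ _*_ (abs-swap q p) (0≤p⇒∣p∣≡p (<⇒≤ 0<pq)) ⟩
    abs (p - q) * (p ⁻¹ * q ⁻¹)        ≤⟨ *-mono-≤ (0≤∣p∣ (p - q)) h (<⇒≤ 0<pq)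
                                            (*-mono-≤ (<⇒≤ (⁻¹-pos 0<p)) (⁻¹-anti 0<d d≤p)
                                                      (<⇒≤ (⁻¹-pos 0<q)) (⁻¹-anti 0<d d≤q)) ⟩
    e * (d ⁻¹ * d ⁻¹)                  ≡⟨ *-comm e (d ⁻¹ * d ⁻¹) ⟩
    (d ⁻¹ * d ⁻¹) * e                  ∎
    where
    open ≤-Reasoning
    0<p = <-≤-trans 0<d d≤p
    0<q = <-≤-trans 0<d d≤q
    0<pq = *-pos (⁻¹-pos 0<p) (⁻¹-pos 0<q)

  ⁻¹-cauchy : ∀ {x d} → 0ℚ < d → EventuallyAbove d x → IsCauchy x →
    IsCauchy (λ n → x n ⁻¹)
  ⁻¹-cauchy {x} {d} 0<d (N₂ , H₂) cx =
    cauchy-upTo (λ n → x n ⁻¹) (d ⁻¹ * d ⁻¹) (*-pos (⁻¹-pos 0<d) (⁻¹-pos 0<d)) λ e 0<e →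
    let N₁ , H₁ = cx e 0<e in
    N₁ ℕ.⊔ N₂ , λ m n N≤m N≤n →
      ⁻¹-diff≤ 0<d (H₂ m (ℕₚ.m⊔n≤o⇒n≤o N₁ N₂ N≤m)) (H₂ n (ℕₚ.m⊔n≤o⇒n≤o N₁ N₂ N≤n))
        (H₁ m n (ℕₚ.m⊔n≤o⇒m≤o N₁ N₂ N≤m) (ℕₚ.m⊔n≤o⇒m≤o N₁ N₂ N≤n))

  pow½ : ℕ → ℚ
  pow½ zero    = 1ℚ
  pow½ (suc k) = ½ * pow½ k

  0<pow½ : ∀ k → 0ℚ < pow½ k
  0<pow½ zero    = 0<1
  0<pow½ (suc k) = *-pos 0<½ (0<pow½ k)

  toℚᵘ-/ : ∀ i d → toℚᵘ (i / suc d) ℚᵘ.≃ ℚᵘ.mkℚᵘ i d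
  toℚᵘ-/ i d = toℚᵘ-fromℚᵘ (ℚᵘ.mkℚᵘ i d)

  1/n≤ : ∀ e → 0ℚ < e → ∃ λ N → ∀ n → N ℕ.≤ n → + 1 / suc n ≤ e
  1/n≤ e@(mkℚ +[1+ p ] d c) _ = d , λ n d≤n → toℚᵘ-cancel-≤
    (ℚᵘₚ.≤-respˡ-≃ (ℚᵘₚ.≃-sym (toℚᵘ-/ (+ 1) n)) (ℚᵘ.*≤*
      (ℤ.+≤+ (ℕₚ.≤-trans (ℕₚ.≤-reflexive (ℕₚ.+-identityʳ (suc d)))
        (ℕₚ.≤-trans (s≤s d≤n) (ℕₚ.m≤m+n (suc n) (p ℕ.* suc n)))))))
  1/n≤ (mkℚ (+ 0) d c) 0<e with positive 0<e
  ... | ()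
  1/n≤ (mkℚ -[1+ n ] d c) 0<e with positive 0<e
  ... | ()

  pow½≤1/n : ∀ k → pow½ k ≤ + 1 / suc k
  pow½≤1/n zero    = ≤-refl
  pow½≤1/n (suc k) = ≤-trans
    (*-monoˡ-≤-nonNeg ½ {{nonNegative (<⇒≤ 0<½)}} (pow½≤1/n k))
    (toℚᵘ-cancel-≤ (ℚᵘₚ.≤-respˡ-≃ (ℚᵘₚ.≃-sym lhs)
      (ℚᵘₚ.≤-respʳ-≃ (ℚᵘₚ.≃-sym (toℚᵘ-/ (+ 1) (suc k)))
        (ℚᵘ.*≤* (ℤ.+≤+ (subst₂ ℕ._≤_
          (sym (ℕₚ.+-identityʳ (suc (suc k)))) eq
          (ℕₚ.m≤n+m (suc (suc k)) k)))))))
    where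
    lhs : toℚᵘ (½ * (+ 1 / suc k)) ℚᵘ.≃ toℚᵘ ½ ℚᵘ.* ℚᵘ.mkℚᵘ (+ 1) k
    lhs = ℚᵘₚ.≃-trans (toℚᵘ-homo-* ½ (+ 1 / suc k))
      (ℚᵘₚ.*-congˡ {toℚᵘ ½} (toℚᵘ-/ (+ 1) k))
    eq : k ℕ.+ suc (suc k) ≡ suc k ℕ.+ (suc k ℕ.+ 0) ℕ.+ 0
    eq = trans (ℕₚ.+-suc k (suc k)) (cong suc (sym
      (trans (ℕₚ.+-identityʳ _) (cong (k ℕ.+_) (ℕₚ.+-identityʳ (suc k))))))

  pow½-small : ∀ e → 0ℚ < e → ∃ λ k → pow½ k ≤ e
  pow½-small e 0<e with 1/n≤ e 0<e
  ... | N , H = N , ≤-trans (pow½≤1/n N) (H N ℕₚ.≤-refl)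

  mid : ℚ → ℚ → ℚ
  mid a b = (a + b) * ½

  double-half : ∀ p → (p + p) * ½ ≡ p
  double-half = solve 1 (λ p → (p :+ p) :* con ½ := p) refl

  ½-mono : ∀ {p q} → p ≤ q → p * ½ ≤ q * ½
  ½-mono = *-monoʳ-≤-nonNeg ½ {{nonNegative (<⇒≤ 0<½)}}

  ≤mid : ∀ {d a b} → d ≤ a → d ≤ b → d ≤ mid a b
  ≤mid {d} {a} {b} d≤a d≤b =
    subst (_≤ mid a b) (double-half d) (½-mono (+-mono-≤ d≤a d≤b))

  mid≤ : ∀ {B a b} → a ≤ B → b ≤ B → mid a b ≤ B
  mid≤ {B} {a} {b} a≤B b≤B =
    subst (mid a b ≤_) (double-half B) (½-mono (+-mono-≤ a≤B b≤B))

  mid-diff : ∀ {a b a′ b′ e} → abs (a - a′) ≤ e → abs (b - b′) ≤ e →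
    abs (mid a b - mid a′ b′) ≤ e
  mid-diff {a} {b} {a′} {b′} {e} h₁ h₂ = begin
    abs (mid a b - mid a′ b′)
      ≡⟨ cong abs (solve 4 (λ a b c d → (a :+ b) :* con ½ :- (c :+ d) :* con ½
                                     := ((a :- c) :+ (b :- d)) :* con ½) refl a b a′ b′) ⟩
    abs (((a - a′) + (b - b′)) * ½)
      ≡⟨ ∣p*q∣≡∣p∣*∣q∣ ((a - a′) + (b - b′)) ½ ⟩
    abs ((a - a′) + (b - b′)) * ½
      ≤⟨ ½-mono (≤-trans (∣p+q∣≤∣p∣+∣q∣ (a - a′) (b - b′)) (+-mono-≤ h₁ h₂)) ⟩
    (e + e) * ½ ≡⟨ double-half e ⟩
    e ∎
    where open ≤-Reasoning

  InRange : ℚ → ℚ → ℚ → Set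
  InRange d B p = d ≤ p × p ≤ B

  mid-range : ∀ {d B a b} → InRange d B a → InRange d B b → InRange d B (mid a b)
  mid-range (d≤a , a≤B) (d≤b , b≤B) = ≤mid d≤a d≤b , mid≤ a≤B b≤B

  Lipschitz : ℚ → ℚ → (ℚ → ℚ → ℚ) → Set
  Lipschitz d B f = ∃ λ c → 0ℚ < c × (∀ a b a′ b′ e → 0ℚ < e →
    InRange d B a → InRange d B b → InRange d B a′ → InRange d B b′ →
    abs (a - a′) ≤ e → abs (b - b′) ≤ e → abs (f a b - f a′ b′) ≤ c * e)

  abs-range : ∀ {d B p} → 0ℚ < d → InRange d B p → abs p ≤ B
  abs-range {d} {B} {p} 0<d (d≤p , p≤B) =
    subst (_≤ B) (sym (0≤p⇒∣p∣≡p (≤-trans (<⇒≤ 0<d) d≤p))) p≤B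

  leftSum-lipschitz : ∀ {d B} → 0ℚ < d → 0ℚ < B → ∀ k → Lipschitz d B (leftSum k)
  leftSum-lipschitz {d} {B} 0<d 0<B zero =
    ((B + B) + d ⁻¹) * L , *-pos (+-pos (+-pos 0<B 0<B) (⁻¹-pos 0<d)) 0<L ,
    λ a b a′ b′ e 0<e ra rb ra′ rb′ h₁ h₂ →
      let 0≤e  = <⇒≤ 0<e
          0<a′ = <-≤-trans 0<d (proj₁ ra′)
          e+e≤ = subst (e + e ≤_) (sym (split e))
                   (subst (_≤ (e + e) + d ⁻¹ * d ⁻¹ * e) (+-identityʳ (e + e))
                     (+-monoʳ-≤ (e + e) (*-nonNeg (<⇒≤ 0<dd) 0≤e)))
          dde≤ = subst (d ⁻¹ * d ⁻¹ * e ≤_) (sym (split e))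
                   (subst (_≤ (e + e) + d ⁻¹ * d ⁻¹ * e) (+-identityˡ (d ⁻¹ * d ⁻¹ * e))
                     (+-monoˡ-≤ (d ⁻¹ * d ⁻¹ * e) (<⇒≤ (+-pos 0<e 0<e))))
      in ≤-trans
        (prod-diff (b - a) (a ⁻¹) (b′ - a′) (a′ ⁻¹) {L * e}
          (*-nonNeg (<⇒≤ 0<L) 0≤e)
          (≤-trans (∣p-q∣≤∣p∣+∣q∣ b a) (+-mono-≤ (abs-range 0<d rb) (abs-range 0<d ra)))
          (subst (_≤ d ⁻¹) (sym (0≤p⇒∣p∣≡p (<⇒≤ (⁻¹-pos 0<a′)))) (⁻¹-anti 0<d (proj₁ ra′)))
          (≤-trans (subst (λ t → abs t ≤ e + e)
              (solve 4 (λ a b c d → (b :- d) :- (a :- c) := (b :- a) :- (d :- c))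
                refl a b a′ b′)
              (≤-trans (∣p-q∣≤∣p∣+∣q∣ (b - b′) (a - a′)) (+-mono-≤ h₂ h₁))) e+e≤)
          (≤-trans (⁻¹-diff≤ 0<d (proj₁ ra) (proj₁ ra′) h₁) dde≤))
        (≤-reflexive (sym (*-assoc ((B + B) + d ⁻¹) L e)))
    where
    L = (1ℚ + 1ℚ) + d ⁻¹ * d ⁻¹
    0<dd = *-pos (⁻¹-pos 0<d) (⁻¹-pos 0<d)
    0<L : 0ℚ < L
    0<L = +-pos (+-pos 0<1 0<1) 0<dd
    split : ∀ e → L * e ≡ (e + e) + d ⁻¹ * d ⁻¹ * e
    split e = solve 2 (λ s e → ((con 1ℚ :+ con 1ℚ) :+ s) :* e := (e :+ e) :+ s :* e)
      refl (d ⁻¹ * d ⁻¹) e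
  leftSum-lipschitz {d} {B} 0<d 0<B (suc k) with leftSum-lipschitz {d} {B} 0<d 0<B k
  ... | c , 0<c , H = c + c , +-pos 0<c 0<c ,
    λ a b a′ b′ e 0<e ra rb ra′ rb′ h₁ h₂ →
      let rm  = mid-range ra rb
          rm′ = mid-range ra′ rb′
          hm  = mid-diff {a} {b} {a′} {b′} h₁ h₂
          p = leftSum k a (mid a b)
          q = leftSum k (mid a b) b
          p′ = leftSum k a′ (mid a′ b′)
          q′ = leftSum k (mid a′ b′) b′
      in subst₂ (λ s t → abs s ≤ t)
        (solve 4 (λ a b c d → (a :- c) :+ (b :- d) := (a :+ b) :- (c :+ d)) refl p q p′ q′)
        (sym (*-distribʳ-+ e c c))
        (≤-trans (∣p+q∣≤∣p∣+∣q∣ (p - p′) (q - q′))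
          (+-mono-≤ (H a (mid a b) a′ (mid a′ b′) e 0<e ra rm ra′ rm′ h₁ hm)
                    (H (mid a b) b (mid a′ b′) b′ e 0<e rm rb rm′ rb′ hm h₂)))

  square-nonNeg : ∀ p → 0ℚ ≤ p * p
  square-nonNeg p with ≤-total 0ℚ p
  ... | inj₁ 0≤p = *-nonNeg 0≤p 0≤p
  ... | inj₂ p≤0 = subst (0ℚ ≤_)
    (solve 1 (λ p → :- p :* :- p := p :* p) refl p)
    (*-nonNeg (neg-antimono-≤ p≤0) (neg-antimono-≤ p≤0))

  osc : ℚ → ℚ → ℚ → ℚ
  osc d a b = ((b - a) * (b - a)) * (d ⁻¹ * d ⁻¹)

  osc-nonNeg : ∀ {d} a b → 0ℚ < d → 0ℚ ≤ osc d a b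
  osc-nonNeg a b 0<d = *-nonNeg (square-nonNeg (b - a))
    (<⇒≤ (*-pos (⁻¹-pos 0<d) (⁻¹-pos 0<d)))

  osc-left : ∀ d a b → osc d a (mid a b) ≡ osc d a b * (½ * ½)
  osc-left d a b = solve 3 (λ s a b →
    (((a :+ b) :* con ½ :- a) :* ((a :+ b) :* con ½ :- a)) :* s
      := (((b :- a) :* (b :- a)) :* s) :* (con ½ :* con ½)) refl (d ⁻¹ * d ⁻¹) a b

  osc-right : ∀ d a b → osc d (mid a b) b ≡ osc d a b * (½ * ½)
  osc-right d a b = solve 3 (λ s a b →
    ((b :- (a :+ b) :* con ½) :* (b :- (a :+ b) :* con ½)) :* s
      := (((b :- a) :* (b :- a)) :* s) :* (con ½ :* con ½)) refl (d ⁻¹ * d ⁻¹) a b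

  refine-step : ∀ {d a b} → 0ℚ < d → d ≤ a → d ≤ b →
    abs ((leftSum 0 a (mid a b) + leftSum 0 (mid a b) b) - leftSum 0 a b)
      ≤ osc d a b * (½ * ½)
  refine-step {d} {a} {b} 0<d d≤a d≤b = begin
    abs (((m - a) * a ⁻¹ + (b - m) * m ⁻¹) - (b - a) * a ⁻¹)
      ≡⟨ cong abs (solve 5 (λ a b m ai mi →
           ((m :- a) :* ai :+ (b :- m) :* mi) :- (b :- a) :* ai
             := (b :- m) :* (mi :- ai)) refl a b m (a ⁻¹) (m ⁻¹)) ⟩
    abs ((b - m) * (m ⁻¹ - a ⁻¹))
      ≡⟨ cong (λ t → abs ((b - m) * t)) (⁻¹-diff 0<m 0<a) ⟩
    abs ((b - m) * ((a - m) * (m ⁻¹ * a ⁻¹)))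
      ≡⟨ cong abs (solve 3 (λ a b s →
           (b :- (a :+ b) :* con ½) :* ((a :- (a :+ b) :* con ½) :* s)
             := :- ((((b :- a) :* con ½) :* ((b :- a) :* con ½)) :* s))
           refl a b (m ⁻¹ * a ⁻¹)) ⟩
    abs (- ((h * h) * (m ⁻¹ * a ⁻¹)))
      ≡⟨ ∣-p∣≡∣p∣ ((h * h) * (m ⁻¹ * a ⁻¹)) ⟩
    abs ((h * h) * (m ⁻¹ * a ⁻¹))
      ≡⟨ 0≤p⇒∣p∣≡p (*-nonNeg (square-nonNeg h) (<⇒≤ (*-pos (⁻¹-pos 0<m) (⁻¹-pos 0<a)))) ⟩
    (h * h) * (m ⁻¹ * a ⁻¹)
      ≤⟨ *-mono-≤ (square-nonNeg h) ≤-refl (<⇒≤ (*-pos (⁻¹-pos 0<m) (⁻¹-pos 0<a)))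
           (*-mono-≤ (<⇒≤ (⁻¹-pos 0<m)) (⁻¹-anti 0<d (≤mid d≤a d≤b))
                     (<⇒≤ (⁻¹-pos 0<a)) (⁻¹-anti 0<d d≤a)) ⟩
    (h * h) * (d ⁻¹ * d ⁻¹)
      ≡⟨ solve 3 (λ s a b → (((b :- a) :* con ½) :* ((b :- a) :* con ½)) :* s
           := (((b :- a) :* (b :- a)) :* s) :* (con ½ :* con ½)) refl (d ⁻¹ * d ⁻¹) a b ⟩
    osc d a b * (½ * ½) ∎
    where
    open ≤-Reasoning
    m = mid a b
    h = (b - a) * ½
    0<a = <-≤-trans 0<d d≤a
    0<m = <-≤-trans 0<d (≤mid d≤a d≤b)

  refine₀ : ∀ {d a b} → 0ℚ < d → d ≤ a → d ≤ b → ∀ k →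
    abs (leftSum k a b - leftSum 0 a b) ≤ osc d a b
  refine₀ {d} {a} {b} 0<d d≤a d≤b zero =
    subst (λ t → abs t ≤ osc d a b) (sym (+-inverseʳ (leftSum 0 a b))) (osc-nonNeg a b 0<d)
  refine₀ {d} {a} {b} 0<d d≤a d≤b (suc k) = begin
    abs ((p + q) - r)
      ≡⟨ cong abs (solve 5 (λ p q p₀ q₀ r → (p :+ q) :- r
           := ((p :- p₀) :+ (q :- q₀)) :+ ((p₀ :+ q₀) :- r)) refl p q p₀ q₀ r) ⟩
    abs (((p - p₀) + (q - q₀)) + ((p₀ + q₀) - r))
      ≤⟨ ∣p+q∣≤∣p∣+∣q∣ ((p - p₀) + (q - q₀)) ((p₀ + q₀) - r) ⟩
    abs ((p - p₀) + (q - q₀)) + abs ((p₀ + q₀) - r)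
      ≤⟨ +-monoˡ-≤ (abs ((p₀ + q₀) - r)) (∣p+q∣≤∣p∣+∣q∣ (p - p₀) (q - q₀)) ⟩
    (abs (p - p₀) + abs (q - q₀)) + abs ((p₀ + q₀) - r)
      ≤⟨ +-mono-≤ (+-mono-≤
           (subst (abs (p - p₀) ≤_) (osc-left d a b) (refine₀ 0<d d≤a d≤m k))
           (subst (abs (q - q₀) ≤_) (osc-right d a b) (refine₀ 0<d d≤m d≤b k)))
           (refine-step 0<d d≤a d≤b) ⟩
    (W * (½ * ½) + W * (½ * ½)) + W * (½ * ½)
      ≡⟨ solve 1 (λ W → (W :* (con ½ :* con ½) :+ W :* (con ½ :* con ½)) :+ W :* (con ½ :* con ½)
           := W :- W :* (con ½ :* con ½)) refl W ⟩
    W - W * (½ * ½)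
      ≤⟨ +-monoʳ-≤ W (neg-antimono-≤ (*-nonNeg (osc-nonNeg a b 0<d) (<⇒≤ (*-pos 0<½ 0<½)))) ⟩
    W + 0ℚ
      ≡⟨ +-identityʳ W ⟩
    W ∎
    where
    open ≤-Reasoning
    m = mid a b
    d≤m = ≤mid d≤a d≤b
    p = leftSum k a m
    q = leftSum k m b
    p₀ = leftSum 0 a m
    q₀ = leftSum 0 m b
    r = leftSum 0 a b
    W = osc d a b

  refine : ∀ {d a b} → 0ℚ < d → d ≤ a → d ≤ b → ∀ n k →
    abs (leftSum (n ℕ.+ k) a b - leftSum n a b) ≤ osc d a b * pow½ n
  refine {d} {a} {b} 0<d d≤a d≤b zero k =
    subst (_ ≤_) (sym (*-identityʳ (osc d a b))) (refine₀ 0<d d≤a d≤b k)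
  refine {d} {a} {b} 0<d d≤a d≤b (suc n) k = begin
    abs ((p + q) - (p₀ + q₀))
      ≡⟨ cong abs (solve 4 (λ p q p₀ q₀ → (p :+ q) :- (p₀ :+ q₀)
           := (p :- p₀) :+ (q :- q₀)) refl p q p₀ q₀) ⟩
    abs ((p - p₀) + (q - q₀))
      ≤⟨ ∣p+q∣≤∣p∣+∣q∣ (p - p₀) (q - q₀) ⟩
    abs (p - p₀) + abs (q - q₀)
      ≤⟨ +-mono-≤
           (subst (λ t → abs (p - p₀) ≤ t * pow½ n) (osc-left d a b) (refine 0<d d≤a d≤m n k))
           (subst (λ t → abs (q - q₀) ≤ t * pow½ n) (osc-right d a b) (refine 0<d d≤m d≤b n k)) ⟩
    (W * (½ * ½)) * pow½ n + (W * (½ * ½)) * pow½ n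
      ≡⟨ solve 2 (λ W x → (W :* (con ½ :* con ½)) :* x :+ (W :* (con ½ :* con ½)) :* x
           := W :* (con ½ :* x)) refl W (pow½ n) ⟩
    W * (½ * pow½ n) ∎
    where
    open ≤-Reasoning
    m = mid a b
    d≤m = ≤mid d≤a d≤b
    p = leftSum (n ℕ.+ k) a m
    q = leftSum (n ℕ.+ k) m b
    p₀ = leftSum n a m
    q₀ = leftSum n m b
    W = osc d a b

  log-cauchy₁ : ∀ {x d} → 0ℚ < d → d ≤ 1ℚ → EventuallyAbove d x → IsCauchy x →
    IsCauchy (λ n → leftSum n 1ℚ (x n))
  log-cauchy₁ {x} {d} 0<d d≤1 (Nd , Hd) cx =
    let B , NB , 0<B , HB = bounded cx
        M  = 1ℚ + B
        0<M = +-pos 0<1 0<B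
        dd = d ⁻¹ * d ⁻¹
        0<dd = *-pos (⁻¹-pos 0<d) (⁻¹-pos 0<d)
        D  = (M * M) * dd
        0<D = *-pos (*-pos 0<M 0<M) 0<dd
        B≤M = subst (_≤ M) (+-identityˡ B) (+-monoˡ-≤ B (<⇒≤ 0<1))
        1≤M = subst (_≤ M) (+-identityʳ 1ℚ) (+-monoʳ-≤ 1ℚ (<⇒≤ 0<B))
        r1 : InRange d M 1ℚ
        r1 = d≤1 , 1≤M
        osc≤D : ∀ q → abs q ≤ B → osc d 1ℚ q ≤ D
        osc≤D q h = *-mono-≤ (square-nonNeg (q - 1ℚ))
          (subst (_≤ M * M) (trans (sym (∣p*q∣≡∣p∣*∣q∣ (q - 1ℚ) (q - 1ℚ)))
                                   (0≤p⇒∣p∣≡p (square-nonNeg (q - 1ℚ))))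
            (*-mono-≤ (0≤∣p∣ (q - 1ℚ)) (q-1≤ q h) (0≤∣p∣ (q - 1ℚ)) (q-1≤ q h)))
          (<⇒≤ 0<dd) ≤-refl
    in cauchy-upTo (λ n → leftSum n 1ℚ (x n)) ((D + 1ℚ) + D) (+-pos (+-pos 0<D 0<1) 0<D) λ e 0<e →
    let k , Hk = pow½-small e 0<e
        c , 0<c , Hc = leftSum-lipschitz {d} {M} 0<d 0<M k
        e′ = e * c ⁻¹
        0<e′ = *-pos 0<e (⁻¹-pos 0<c)
        Nx , Hx = cx e′ 0<e′
        close : ∀ n → k ℕ.≤ n → d ≤ x n → abs (x n) ≤ B →
          abs (leftSum n 1ℚ (x n) - leftSum k 1ℚ (x n)) ≤ D * e
        close n k≤n d≤xn xn≤B = subst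
          (λ j → abs (leftSum j 1ℚ (x n) - leftSum k 1ℚ (x n)) ≤ D * e)
          (ℕₚ.m+[n∸m]≡n k≤n)
          (≤-trans (refine 0<d d≤1 d≤xn k (n ℕ.∸ k))
            (*-mono-≤ (osc-nonNeg 1ℚ (x n) 0<d) (osc≤D (x n) xn≤B) (<⇒≤ (0<pow½ k)) Hk))
    in (k ℕ.⊔ Nx) ℕ.⊔ (Nd ℕ.⊔ NB) , λ m n N≤m N≤n →
    let m₁ = ℕₚ.m⊔n≤o⇒m≤o (k ℕ.⊔ Nx) (Nd ℕ.⊔ NB) N≤m
        m₂ = ℕₚ.m⊔n≤o⇒n≤o (k ℕ.⊔ Nx) (Nd ℕ.⊔ NB) N≤m
        n₁ = ℕₚ.m⊔n≤o⇒m≤o (k ℕ.⊔ Nx) (Nd ℕ.⊔ NB) N≤n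
        n₂ = ℕₚ.m⊔n≤o⇒n≤o (k ℕ.⊔ Nx) (Nd ℕ.⊔ NB) N≤n
        dm = Hd m (ℕₚ.m⊔n≤o⇒m≤o Nd NB m₂)
        dn = Hd n (ℕₚ.m⊔n≤o⇒m≤o Nd NB n₂)
        Bm = HB m (ℕₚ.m⊔n≤o⇒n≤o Nd NB m₂)
        Bn = HB n (ℕₚ.m⊔n≤o⇒n≤o Nd NB n₂)
        u = leftSum m 1ℚ (x m)
        u′ = leftSum k 1ℚ (x m)
        v′ = leftSum k 1ℚ (x n)
        v = leftSum n 1ℚ (x n)
        u~u′ = close m (ℕₚ.m⊔n≤o⇒m≤o k Nx m₁) dm Bm
        v~v′ = close n (ℕₚ.m⊔n≤o⇒m≤o k Nx n₁) dn Bn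
        u′~v′ = subst (abs (u′ - v′) ≤_) (rescale 0<c)
          (Hc 1ℚ (x m) 1ℚ (x n) e′ 0<e′ r1
            (dm , ≤-trans (≤-trans (≤abs (x m)) Bm) B≤M) r1
            (dn , ≤-trans (≤-trans (≤abs (x n)) Bn) B≤M)
            (<⇒≤ 0<e′)
            (Hx m n (ℕₚ.m⊔n≤o⇒n≤o k Nx m₁) (ℕₚ.m⊔n≤o⇒n≤o k Nx n₁)))
    in subst (abs (u - v) ≤_)
      (solve 2 (λ D e → (D :* e :+ e) :+ D :* e := ((D :+ con 1ℚ) :+ D) :* e) refl D e)
      (≤-trans (abs-triangle u v′ v)
        (+-mono-≤ (≤-trans (abs-triangle u u′ v′) (+-mono-≤ u~u′ u′~v′))
          (subst (_≤ D * e) (abs-swap v v′) v~v′)))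
    where
    q-1≤ : ∀ {B} q → abs q ≤ B → abs (q - 1ℚ) ≤ 1ℚ + B
    q-1≤ {B} q h = ≤-trans (∣p-q∣≤∣p∣+∣q∣ q 1ℚ)
      (subst (abs q + 1ℚ ≤_) (+-comm B 1ℚ) (+-monoˡ-≤ 1ℚ h))

  log-cauchy : ∀ {x d} → 0ℚ < d → EventuallyAbove d x → IsCauchy x →
    IsCauchy (λ n → leftSum n 1ℚ (x n))
  log-cauchy {x} {d} 0<d (Nd , Hd) cx with ≤-total d 1ℚ
  ... | inj₁ d≤1 = log-cauchy₁ 0<d d≤1 (Nd , Hd) cx
  ... | inj₂ 1≤d = log-cauchy₁ 0<1 ≤-refl (Nd , λ n h → ≤-trans 1≤d (Hd n h)) cx

  leftSum-lower : ∀ {a b B} → 0ℚ < a → a ≤ b → b ≤ B → ∀ k →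
    (b - a) * B ⁻¹ ≤ leftSum k a b
  leftSum-lower {a} {b} {B} 0<a a≤b b≤B zero =
    *-monoˡ-≤-nonNeg (b - a) {{nonNegative (p≤q⇒0≤q-p a≤b)}}
      (⁻¹-anti 0<a (≤-trans a≤b b≤B))
  leftSum-lower {a} {b} {B} 0<a a≤b b≤B (suc k) = subst (_≤ leftSum (suc k) a b)
    (solve 4 (λ a b m i → (m :- a) :* i :+ (b :- m) :* i := (b :- a) :* i)
      refl a b (mid a b) (B ⁻¹))
    (+-mono-≤ (leftSum-lower 0<a a≤m (≤-trans m≤b b≤B) k)
              (leftSum-lower (<-≤-trans 0<a a≤m) m≤b b≤B k))
    where
    a≤m = ≤mid ≤-refl a≤b
    m≤b = mid≤ a≤b ≤-refl

  isqrt-lower : ∀ n → isqrt n ℕ.* isqrt n ℕ.≤ n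
  isqrt-lower zero = z≤n
  isqrt-lower (suc n) with isqrt n | isqrt-lower n
  ... | s | ih with suc s ℕ.* suc s ℕ.≤? suc n
  ...   | yes h = h
  ...   | no _  = ℕₚ.m≤n⇒m≤1+n ih

  isqrt-upper : ∀ n → n ℕ.< suc (isqrt n) ℕ.* suc (isqrt n)
  isqrt-upper zero = s≤s z≤n
  isqrt-upper (suc n) with isqrt n | isqrt-upper n
  ... | s | ih with suc s ℕ.* suc s ℕ.≤? suc n
  ...   | yes h = ℕₚ.<-≤-trans (s≤s ih)
                    (ℕₚ.*-mono-< (ℕₚ.n<1+n (suc s)) (ℕₚ.n<1+n (suc s)))
  ...   | no h  = ℕₚ.≰⇒> h

  square-cancel-≤ : ∀ {a b} → a ℕ.* a ℕ.< b ℕ.* b → a ℕ.≤ b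
  square-cancel-≤ {a} {b} h with a ℕ.≤? b
  ... | yes a≤b = a≤b
  ... | no  a≰b = ⊥-elim (ℕₚ.<⇒≱ h
    (ℕₚ.*-mono-≤ (ℕₚ.<⇒≤ (ℕₚ.≰⇒> a≰b)) (ℕₚ.<⇒≤ (ℕₚ.≰⇒> a≰b))))

  isqrt-cross : ∀ n K M →
    isqrt (n ℕ.* (K ℕ.* K)) ℕ.* suc M ℕ.≤ suc (isqrt (n ℕ.* (suc M ℕ.* suc M))) ℕ.* K
  isqrt-cross n zero M = ℕₚ.≤-reflexive (trans
    (cong (λ t → isqrt t ℕ.* suc M) (ℕₚ.*-zeroʳ n))
    (sym (ℕₚ.*-zeroʳ (suc (isqrt (n ℕ.* (suc M ℕ.* suc M)))))))
  isqrt-cross n K@(suc _) M = square-cancel-≤ (begin-strict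
    (a ℕ.* m) ℕ.* (a ℕ.* m)         ≡⟨ swap a m ⟩
    (a ℕ.* a) ℕ.* (m ℕ.* m)         ≤⟨ ℕₚ.*-monoˡ-≤ (m ℕ.* m) (isqrt-lower (n ℕ.* (K ℕ.* K))) ⟩
    (n ℕ.* (K ℕ.* K)) ℕ.* (m ℕ.* m) ≡⟨ ℕₚ.*-assoc n (K ℕ.* K) (m ℕ.* m) ⟩
    n ℕ.* ((K ℕ.* K) ℕ.* (m ℕ.* m)) ≡⟨ cong (n ℕ.*_) (ℕₚ.*-comm (K ℕ.* K) (m ℕ.* m)) ⟩
    n ℕ.* ((m ℕ.* m) ℕ.* (K ℕ.* K)) ≡⟨ ℕₚ.*-assoc n (m ℕ.* m) (K ℕ.* K) ⟨
    (n ℕ.* (m ℕ.* m)) ℕ.* (K ℕ.* K) <⟨ ℕₚ.*-monoˡ-< (K ℕ.* K) (isqrt-upper (n ℕ.* (m ℕ.* m))) ⟩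
    (b ℕ.* b) ℕ.* (K ℕ.* K)         ≡⟨ swap b K ⟨
    (b ℕ.* K) ℕ.* (b ℕ.* K)         ∎)
    where
    open ℕₚ.≤-Reasoning
    m = suc M
    a = isqrt (n ℕ.* (K ℕ.* K))
    b = suc (isqrt (n ℕ.* (m ℕ.* m)))
    swap : ∀ p q → (p ℕ.* q) ℕ.* (p ℕ.* q) ≡ (p ℕ.* p) ℕ.* (q ℕ.* q)
    swap p q = ℕₚ.[m*n]*[o*p]≡[m*o]*[n*p] p q p q

  sqrtApprox-step : ∀ n k m → sqrtApprox n k ≤ sqrtApprox n m + (+ 1 / suc m)
  sqrtApprox-step n k m = toℚᵘ-cancel-≤
    (ℚᵘₚ.≤-respˡ-≃ (ℚᵘₚ.≃-sym (toℚᵘ-/ (+ a) k))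
      (ℚᵘₚ.≤-respʳ-≃ (ℚᵘₚ.≃-sym rhs) (ℚᵘ.*≤*
        (subst₂ ℤ._≤_ (ℤₚ.pos-* a (M ℕ.* M))
          (trans (ℤₚ.pos-* (b ℕ.* M ℕ.+ 1 ℕ.* M) K)
            (cong (ℤ._* + K) (trans (ℤₚ.pos-+ (b ℕ.* M) (1 ℕ.* M))
              (cong₂ ℤ._+_ (ℤₚ.pos-* b M) (ℤₚ.pos-* 1 M)))))
          (ℤ.+≤+ main)))))
    where
    K = suc k
    M = suc m
    a = isqrt (n ℕ.* (K ℕ.* K))
    b = isqrt (n ℕ.* (M ℕ.* M))
    rhs : toℚᵘ (sqrtApprox n m + (+ 1 / suc m)) ℚᵘ.≃ ℚᵘ.mkℚᵘ (+ b) m ℚᵘ.+ ℚᵘ.mkℚᵘ (+ 1) m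
    rhs = ℚᵘₚ.≃-trans (toℚᵘ-homo-+ (sqrtApprox n m) (+ 1 / suc m))
      (ℚᵘₚ.+-cong (toℚᵘ-/ (+ b) m) (toℚᵘ-/ (+ 1) m))
    main : a ℕ.* (M ℕ.* M) ℕ.≤ (b ℕ.* M ℕ.+ 1 ℕ.* M) ℕ.* K
    main = begin
      a ℕ.* (M ℕ.* M)               ≡⟨ ℕₚ.*-assoc a M M ⟨
      (a ℕ.* M) ℕ.* M               ≤⟨ ℕₚ.*-monoˡ-≤ M (isqrt-cross n K m) ⟩
      (suc b ℕ.* K) ℕ.* M           ≡⟨ ℕₚ.*-assoc (suc b) K M ⟩
      suc b ℕ.* (K ℕ.* M)           ≡⟨ cong (suc b ℕ.*_) (ℕₚ.*-comm K M) ⟩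
      suc b ℕ.* (M ℕ.* K)           ≡⟨ ℕₚ.*-assoc (suc b) M K ⟨
      (suc b ℕ.* M) ℕ.* K           ≡⟨ cong (λ t → (t ℕ.* M) ℕ.* K) (ℕₚ.+-comm 1 b) ⟩
      ((b ℕ.+ 1) ℕ.* M) ℕ.* K       ≡⟨ cong (ℕ._* K) (ℕₚ.*-distribʳ-+ M b 1) ⟩
      (b ℕ.* M ℕ.+ 1 ℕ.* M) ℕ.* K   ∎
      where open ℕₚ.≤-Reasoning

  sqrt-cauchy : ∀ n → IsCauchy (sqrtApprox n)
  sqrt-cauchy n e 0<e with 1/n≤ e 0<e
  ... | N , H = N , λ j k N≤j N≤k → abs≤ (half j k (H k N≤k))
    (subst (_≤ e) (solve 2 (λ a b → a :- b := :- (b :- a)) refl (s k) (s j))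
      (half k j (H j N≤j)))
    where
    s = sqrtApprox n
    half : ∀ j k → + 1 / suc k ≤ e → s j - s k ≤ e
    half j k h = subst (s j - s k ≤_)
      (solve 2 (λ a e → (a :+ e) :- a := e) refl (s k) e)
      (+-monoˡ-≤ (- s k) (≤-trans (sqrtApprox-step n j k) (+-monoʳ-≤ (s k) h)))

-- Real numbers as Cauchy sequences of rationals; there is no quotient, and
-- only the order relations below are used to compare them.
record ℝ : Set where
  no-eta-equality
  field
    seq    : ℕ → ℚ
    cauchy : IsCauchy seq

open ℝ public

infix 4 _<_ _≤_
infixl 6 _+_ _-_
infixl 7 _*_ _÷_
infix 8 1/_ √_

record _<_ (x y : ℝ) : Set where
  field
    gap       : ℚ
    gap>0     : 0ℚ ℚ.< gap
    from      : ℕ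
    separated : ∀ n → from ℕ.≤ n → seq x n ℚ.+ gap ℚ.≤ seq y n

_≤_ : ℝ → ℝ → Set
x ≤ y = ¬ (y < x)

fromℚ : ℚ → ℝ
seq    (fromℚ p) _ = p
cauchy (fromℚ p)   = Auxiliary.const-cauchy p

fromℤ : ℤ → ℝ
fromℤ i = fromℚ (i ℚ./ 1)

fromℕ : ℕ → ℝ
fromℕ n = fromℤ (+ n)

0ℝ 1ℝ : ℝ
seq    0ℝ _ = 0ℚ
cauchy 0ℝ   = Auxiliary.const-cauchy 0ℚ
seq    1ℝ _ = 1ℚ
cauchy 1ℝ   = Auxiliary.const-cauchy 1ℚ

_+_ _-_ _*_ : ℝ → ℝ → ℝ
seq    (x + y) n = seq x n ℚ.+ seq y n
cauchy (x + y)   = Auxiliary.+-cauchy {seq x} {seq y} (cauchy x) (cauchy y)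
seq    (x - y) n = seq x n ℚ.- seq y n
cauchy (x - y)   = Auxiliary.+-cauchy {seq x} {λ n → ℚ.- seq y n} (cauchy x)
  (Auxiliary.neg-cauchy {seq y} (cauchy y))
seq    (x * y) n = seq x n ℚ.* seq y n
cauchy (x * y)   = Auxiliary.*-cauchy {seq x} {seq y} (cauchy x) (cauchy y)

positive⇒above : ∀ {x} (0<x : 0ℝ < x) →
  Auxiliary.EventuallyAbove (_<_.gap 0<x) (seq x)
positive⇒above {x} 0<x = from , λ n h →
  subst (ℚ._≤ seq x n) (ℚₚ.+-identityˡ gap) (separated n h)
  where open _<_ 0<x

1/_ : (x : ℝ) → {{0ℝ < x}} → ℝ
seq    ((1/ x) {{0<x}}) n = seq x n ⁻¹
cauchy ((1/ x) {{0<x}})   = Auxiliary.⁻¹-cauchy {seq x} (_<_.gap>0 0<x) (positive⇒above 0<x) (cauchy x)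

_÷_ : (x y : ℝ) → {{0ℝ < y}} → ℝ
x ÷ y = x * 1/ y

-- The natural logarithm ∫₁ˣ dt/t.  At stage n the Riemann sum with 2ⁿ
-- intervals is evaluated at the n-th rational approximation of x.
log : (x : ℝ) → {{0ℝ < x}} → ℝ
seq    (log x {{0<x}}) n = leftSum n 1ℚ (seq x n)
cauchy (log x {{0<x}})   = Auxiliary.log-cauchy {seq x} (_<_.gap>0 0<x) (positive⇒above 0<x) (cauchy x)

√_ : ℕ → ℝ
seq    (√ n) = sqrtApprox n
cauchy (√ n) = Auxiliary.sqrt-cauchy n

-- r = ⌈x⌉.  A relation, since the ceiling is not a computable function on ℝ.
IsCeiling : ℝ → ℤ → Set
IsCeiling x r = x ≤ fromℤ r × fromℤ r - 1ℝ < x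

-- Positivity and size facts found by instance search, so that 1/_, _÷_ and
-- log can be applied without naming a proof.
module _ {x y : ℝ} where
  open Auxiliary

  instance
    *-positive : {{0ℝ < x}} → {{0ℝ < y}} → 0ℝ < x * y
    *-positive {{0<x}} {{0<y}} = record
      { gap = X.gap ℚ.* Y.gap
      ; gap>0 = *-pos X.gap>0 Y.gap>0
      ; from = X.from ℕ.⊔ Y.from
      ; separated = λ n h → subst (ℚ._≤ seq x n ℚ.* seq y n)
          (sym (ℚₚ.+-identityˡ (X.gap ℚ.* Y.gap)))
          (*-mono-≤ (ℚₚ.<⇒≤ X.gap>0) (proj₂ (positive⇒above 0<x) n (ℕₚ.m⊔n≤o⇒m≤o X.from Y.from h))
                    (ℚₚ.<⇒≤ Y.gap>0) (proj₂ (positive⇒above 0<y) n (ℕₚ.m⊔n≤o⇒n≤o X.from Y.from h)))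
      }
      where
      module X = _<_ 0<x
      module Y = _<_ 0<y

    *-below-1 : {{0ℝ < x}} → {{x < 1ℝ}} → {{0ℝ < y}} → {{y < 1ℝ}} → x * y < 1ℝ
    *-below-1 {{0<x}} {{x<1}} {{0<y}} {{y<1}} = record
      { gap = Y₁.gap
      ; gap>0 = Y₁.gap>0
      ; from = (X.from ℕ.⊔ X₁.from) ℕ.⊔ (Y.from ℕ.⊔ Y₁.from)
      ; separated = λ n h →
          let hx = ℕₚ.m⊔n≤o⇒m≤o (X.from ℕ.⊔ X₁.from) (Y.from ℕ.⊔ Y₁.from) h
              hy = ℕₚ.m⊔n≤o⇒n≤o (X.from ℕ.⊔ X₁.from) (Y.from ℕ.⊔ Y₁.from) h
              0≤x = ℚₚ.≤-trans (ℚₚ.<⇒≤ X.gap>0)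
                (proj₂ (positive⇒above 0<x) n (ℕₚ.m⊔n≤o⇒m≤o X.from X₁.from hx))
              0≤y = ℚₚ.≤-trans (ℚₚ.<⇒≤ Y.gap>0)
                (proj₂ (positive⇒above 0<y) n (ℕₚ.m⊔n≤o⇒m≤o Y.from Y₁.from hy))
              x≤1 = ℚₚ.≤-trans
                (subst (ℚ._≤ seq x n ℚ.+ X₁.gap) (ℚₚ.+-identityʳ (seq x n))
                  (ℚₚ.+-monoʳ-≤ (seq x n) (ℚₚ.<⇒≤ X₁.gap>0)))
                (X₁.separated n (ℕₚ.m⊔n≤o⇒n≤o X.from X₁.from hx))
          in ℚₚ.≤-trans
            (ℚₚ.+-monoˡ-≤ Y₁.gap (subst (seq x n ℚ.* seq y n ℚ.≤_) (ℚₚ.*-identityˡ (seq y n))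
              (*-mono-≤ 0≤x x≤1 0≤y ℚₚ.≤-refl)))
            (Y₁.separated n (ℕₚ.m⊔n≤o⇒n≤o Y.from Y₁.from hy))
      }
      where
      module X = _<_ 0<x
      module X₁ = _<_ x<1
      module Y = _<_ 0<y
      module Y₁ = _<_ y<1

module _ {x : ℝ} where
  open Auxiliary

  instance
    1/-positive : {{_ : 0ℝ < x}} → 0ℝ < 1/ x
    1/-positive {{0<x}} =
      let B , N , 0<B , H = bounded {seq x} (cauchy x)
          N′ , H′ = positive⇒above 0<x
      in record
      { gap = B ⁻¹
      ; gap>0 = ⁻¹-pos 0<B
      ; from = N ℕ.⊔ N′
      ; separated = λ n h → subst (ℚ._≤ seq x n ⁻¹) (sym (ℚₚ.+-identityˡ (B ⁻¹)))
          (⁻¹-anti (ℚₚ.<-≤-trans (_<_.gap>0 0<x) (H′ n (ℕₚ.m⊔n≤o⇒n≤o N N′ h)))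
            (ℚₚ.≤-trans (≤abs (seq x n)) (H n (ℕₚ.m⊔n≤o⇒m≤o N N′ h))))
      }

    1/-above-1 : {{_ : 0ℝ < x}} → {{x < 1ℝ}} → 1ℝ < 1/ x
    1/-above-1 {{0<x}} {{x<1}} = record
      { gap = g
      ; gap>0 = gap>0
      ; from = N ℕ.⊔ from
      ; separated = λ n h →
          let xn = seq x n
              0<xn = ℚₚ.<-≤-trans (_<_.gap>0 0<x) (H n (ℕₚ.m⊔n≤o⇒m≤o N from h))
              xn+g≤1 = separated n (ℕₚ.m⊔n≤o⇒n≤o N from h)
              xn≤1 = ℚₚ.≤-trans (subst (ℚ._≤ xn ℚ.+ g) (ℚₚ.+-identityʳ xn)
                       (ℚₚ.+-monoʳ-≤ xn (ℚₚ.<⇒≤ gap>0))) xn+g≤1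
              0≤i = ℚₚ.<⇒≤ (⁻¹-pos 0<xn)
          in begin
            1ℚ ℚ.+ g                         ≡⟨ cong₂ ℚ._+_ (sym (⁻¹-inverseʳ 0<xn)) (sym (ℚₚ.*-identityʳ g)) ⟩
            xn ℚ.* xn ⁻¹ ℚ.+ g ℚ.* 1ℚ ⁻¹     ≤⟨ ℚₚ.+-monoʳ-≤ (xn ℚ.* xn ⁻¹)
                                                  (ℚₚ.*-monoˡ-≤-nonNeg g {{ℚ.nonNegative (ℚₚ.<⇒≤ gap>0)}} (⁻¹-anti 0<xn xn≤1)) ⟩
            xn ℚ.* xn ⁻¹ ℚ.+ g ℚ.* xn ⁻¹     ≡⟨ ℚₚ.*-distribʳ-+ (xn ⁻¹) xn g ⟨
            (xn ℚ.+ g) ℚ.* xn ⁻¹             ≤⟨ ℚₚ.*-monoʳ-≤-nonNeg (xn ⁻¹) {{ℚ.nonNegative 0≤i}} xn+g≤1 ⟩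
            1ℚ ℚ.* xn ⁻¹                     ≡⟨ ℚₚ.*-identityˡ (xn ⁻¹) ⟩
            xn ⁻¹ ∎
      }
      where
      open _<_ x<1 renaming (gap to g)
      open ℚₚ.≤-Reasoning
      N = proj₁ (positive⇒above 0<x)
      H = proj₂ (positive⇒above 0<x)

    log-positive : {{_ : 0ℝ < x}} → {{1ℝ < x}} → 0ℝ < log x
    log-positive {{0<x}} {{1<x}} =
      let B , N , 0<B , H = bounded {seq x} (cauchy x)
      in record
      { gap = gap ℚ.* B ⁻¹
      ; gap>0 = *-pos gap>0 (⁻¹-pos 0<B)
      ; from = N ℕ.⊔ from
      ; separated = λ n h →
          let xn = seq x n
              1+g≤xn = separated n (ℕₚ.m⊔n≤o⇒n≤o N from h)
              1≤xn = ℚₚ.≤-trans (subst (ℚ._≤ 1ℚ ℚ.+ gap) (ℚₚ.+-identityʳ 1ℚ)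
                       (ℚₚ.+-monoʳ-≤ 1ℚ (ℚₚ.<⇒≤ gap>0))) 1+g≤xn
              g≤xn-1 = p+q≤r⇒p≤r-q {gap} {1ℚ} (subst (ℚ._≤ xn) (ℚₚ.+-comm 1ℚ gap) 1+g≤xn)
          in subst (ℚ._≤ leftSum n 1ℚ xn) (sym (ℚₚ.+-identityˡ (gap ℚ.* B ⁻¹)))
            (ℚₚ.≤-trans
              (ℚₚ.*-monoʳ-≤-nonNeg (B ⁻¹) {{ℚ.nonNegative (ℚₚ.<⇒≤ (⁻¹-pos 0<B))}} g≤xn-1)
              (leftSum-lower 0<1 1≤xn
                (ℚₚ.≤-trans (≤abs xn) (H n (ℕₚ.m⊔n≤o⇒m≤o N from h))) n))
      }
      where open _<_ 1<x

record Family (n k : ℕ) : Set₁ where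
  field
    Member  : Pred (Subset n) 0ℓ
    member? : Decidable Member
    uniform : ∀ {S} → Member S → ∣ S ∣ ≡ k

open Family public

infix  4 _≈_ _≉_
infix  9 _ᶜ
infixr 7 _∩_

_≈_ _≉_ : ∀ {n k} → Family n k → Family n k → Set
𝒜 ≈ ℬ = ∀ S → Member 𝒜 S ⇔ Member ℬ S
𝒜 ≉ ℬ = ¬ (𝒜 ≈ ℬ)

∅ : ∀ {n k} → Family n k
Member  ∅ _ = ⊥
member? ∅ _ = no λ ()
uniform ∅ ()

layer : ∀ n k → Family n k
Member  (layer n k) S = ∣ S ∣ ≡ k
member? (layer n k) S = ∣ S ∣ ℕ.≟ k
uniform (layer n k) p = p

_ᶜ : ∀ {n k} → Family n k → Family n k
Member  (_ᶜ {k = k} 𝒜) S = ∣ S ∣ ≡ k × ¬ Member 𝒜 S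
member? (_ᶜ {k = k} 𝒜) S = (∣ S ∣ ℕ.≟ k) ×-dec ¬? (member? 𝒜 S)
uniform (𝒜 ᶜ) = proj₁

_∩_ : ∀ {n k} → Family n k → Family n k → Family n k
Member  (𝒜 ∩ ℬ) S = Member 𝒜 S × Member ℬ S
member? (𝒜 ∩ ℬ) S = member? 𝒜 S ×-dec member? ℬ S
uniform (𝒜 ∩ ℬ) = uniform 𝒜 ∘ proj₁

∂⁺ : ∀ {n k} r → Family n k → Family n (k ℕ.+ r)
Member  (∂⁺ {k = k} r 𝒜) B = ∣ B ∣ ≡ k ℕ.+ r × ∃ λ A → Member 𝒜 A × A ⊆ˢ B
member? (∂⁺ {k = k} r 𝒜) B =
  (∣ B ∣ ℕ.≟ k ℕ.+ r) ×-dec anySubset? (λ A → member? 𝒜 A ×-dec A ⊆? B)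
uniform (∂⁺ r 𝒜) = proj₁

subsets : ∀ n → List (Subset n)
subsets zero    = [] ∷ˡ []ˡ
subsets (suc n) = map (outside ∷_) (subsets n) ++ map (inside ∷_) (subsets n)

card : ∀ {n k} → Family n k → ℕ
card {n} 𝒜 = length (filter (member? 𝒜) (subsets n))

-- Only used with a denominator n C k, which vanishes just when the layer is
-- empty (k > n); the measure on an empty layer is zero.
ratio : ℕ → ℕ → ℚ
ratio a zero    = 0ℚ
ratio a (suc b) = + a ℚ./ suc b

μ : ∀ {n k} → Family n k → ℝ
seq    (μ {n} {k} 𝒜) _ = ratio (card 𝒜) (n C k)
cauchy (μ {n} {k} 𝒜)   = Auxiliary.const-cauchy (ratio (card 𝒜) (n C k))

record Proper {n k : ℕ} (𝒜 : Family n k) : Set where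
  field
    ≉∅     : 𝒜 ≉ ∅
    ≉layer : 𝒜 ≉ layer n k

module Counting where

  module _ {A : Set} {P Q : Pred A 0ℓ} (P? : Decidable P) (Q? : Decidable Q)
           (P⊆Q : ∀ {x} → P x → Q x) where

    count-mono : ∀ xs → length (filter P? xs) ℕ.≤ length (filter Q? xs)
    count-mono []ˡ = z≤n
    count-mono (x ∷ˡ xs) with P? x | Q? x
    ... | yes _  | yes _  = s≤s (count-mono xs)
    ... | yes px | no ¬qx = ⊥-elim (¬qx (P⊆Q px))
    ... | no _   | yes _  = ℕₚ.m≤n⇒m≤1+n (count-mono xs)
    ... | no _   | no _   = count-mono xs

    count-eq⇒⊇ : ∀ xs → length (filter Q? xs) ℕ.≤ length (filter P? xs) →
      ∀ {x} → x ∈ˡ xs → Q x → P x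
    count-eq⇒⊇ (x ∷ˡ xs) h x∈ qx with P? x | Q? x
    count-eq⇒⊇ (x ∷ˡ xs) h (here refl) qx | yes px | _ = px
    count-eq⇒⊇ (x ∷ˡ xs) (s≤s h) (there x∈) qx | yes _ | yes _ = count-eq⇒⊇ xs h x∈ qx
    count-eq⇒⊇ (x ∷ˡ xs) h (there x∈) qx | yes px | no ¬qx = ⊥-elim (¬qx (P⊆Q px))
    count-eq⇒⊇ (x ∷ˡ xs) h _ qx | no _ | yes _ =
      ⊥-elim (ℕₚ.<⇒≱ h (count-mono xs))
    count-eq⇒⊇ (x ∷ˡ xs) h (here refl) qx | no _ | no ¬qx = ⊥-elim (¬qx qx)
    count-eq⇒⊇ (x ∷ˡ xs) h (there x∈) qx | no _ | no _ = count-eq⇒⊇ xs h x∈ qx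

  count-cong : ∀ {A : Set} {P Q : Pred A 0ℓ} (P? : Decidable P) (Q? : Decidable Q) →
    (∀ {x} → P x → Q x) → (∀ {x} → Q x → P x) → ∀ xs →
    length (filter P? xs) ≡ length (filter Q? xs)
  count-cong P? Q? f g xs = ℕₚ.≤-antisym (count-mono P? Q? f xs) (count-mono Q? P? g xs)

  count-none : ∀ {A : Set} {P : Pred A 0ℓ} (P? : Decidable P) → (∀ x → ¬ P x) →
    ∀ xs → length (filter P? xs) ≡ 0
  count-none P? ¬p []ˡ = refl
  count-none P? ¬p (x ∷ˡ xs) with P? x
  ... | yes px = ⊥-elim (¬p x px)
  ... | no _   = count-none P? ¬p xs

  count-map : ∀ {A B : Set} {P : Pred B 0ℓ} (P? : Decidable P) (f : A → B) → ∀ xs →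
    length (filter P? (map f xs)) ≡ length (filter (λ x → P? (f x)) xs)
  count-map P? f []ˡ = refl
  count-map P? f (x ∷ˡ xs) with P? (f x)
  ... | yes _ = cong suc (count-map P? f xs)
  ... | no _  = count-map P? f xs

  ∈-subsets : ∀ {n} (S : Subset n) → S ∈ˡ subsets n
  ∈-subsets [] = here refl
  ∈-subsets (outside ∷ S) = ∈-++⁺ˡ (∈-map⁺ (outside ∷_) (∈-subsets S))
  ∈-subsets {suc n} (inside ∷ S) =
    ∈-++⁺ʳ (map (outside ∷_) (subsets n)) (∈-map⁺ (inside ∷_) (∈-subsets S))

  layer-split : ∀ n k → card (layer (suc n) k) ≡
    length (filter (λ S → ∣ S ∣ ℕ.≟ k) (subsets n)) ℕ.+
    length (filter (λ S → suc ∣ S ∣ ℕ.≟ k) (subsets n))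
  layer-split n k = begin
    length (filter P? (l₀ ++ l₁))
      ≡⟨ cong length (Listₚ.filter-++ P? l₀ l₁) ⟩
    length (filter P? l₀ ++ filter P? l₁)
      ≡⟨ Listₚ.length-++ (filter P? l₀) ⟩
    length (filter P? l₀) ℕ.+ length (filter P? l₁)
      ≡⟨ cong₂ ℕ._+_ (count-map P? (outside ∷_) (subsets n)) (count-map P? (inside ∷_) (subsets n)) ⟩
    _ ∎
    where
    open ≡-Reasoning
    P? = member? (layer (suc n) k)
    l₀ = map (outside ∷_) (subsets n)
    l₁ = map (inside ∷_) (subsets n)

  card-layer : ∀ n k → card (layer n k) ≡ n C k
  card-layer zero    zero    = refl
  card-layer zero    (suc k) = refl
  card-layer (suc n) zero    = begin
    card (layer (suc n) 0)   ≡⟨ layer-split n 0 ⟩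
    card (layer n 0) ℕ.+ _   ≡⟨ cong₂ ℕ._+_ (card-layer n 0) (count-none _ (λ S ()) (subsets n)) ⟩
    n C 0 ℕ.+ 0              ≡⟨ ℕₚ.+-identityʳ (n C 0) ⟩
    suc n C 0                ∎
    where open ≡-Reasoning
  card-layer (suc n) (suc k) = begin
    card (layer (suc n) (suc k))
      ≡⟨ layer-split n (suc k) ⟩
    card (layer n (suc k)) ℕ.+ _
      ≡⟨ cong₂ ℕ._+_ (card-layer n (suc k))
           (trans (count-cong _ (λ S → ∣ S ∣ ℕ.≟ k) ℕₚ.suc-injective (cong suc) (subsets n))
             (card-layer n k)) ⟩
    n C suc k ℕ.+ n C k   ≡⟨ ℕₚ.+-comm (n C suc k) (n C k) ⟩
    n C k ℕ.+ n C suc k   ≡⟨ nCk+nC[k+1]≡[n+1]C[k+1] n k ⟩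
    suc n C suc k         ∎
    where open ≡-Reasoning

  card-positive : ∀ {n k} (𝒜 : Family n k) → 𝒜 ≉ ∅ → 0 ℕ.< card 𝒜
  card-positive {n} 𝒜 ne = ℕₚ.≰⇒> λ h → ne λ S →
    mk⇔ (λ S∈ → count-eq⇒⊇ (member? (∅ {n} {0})) (member? 𝒜) (λ ()) (subsets n)
          (ℕₚ.≤-trans h z≤n) (∈-subsets S) S∈)
        λ ()

  card-below : ∀ {n k} (𝒜 : Family n k) → 𝒜 ≉ layer n k → card 𝒜 ℕ.< n C k
  card-below {n} {k} 𝒜 ne = subst (card 𝒜 ℕ.<_) (card-layer n k)
    (ℕₚ.≰⇒> λ h → ne λ S → mk⇔ (uniform 𝒜)
      (count-eq⇒⊇ (member? 𝒜) (member? (layer n k)) (uniform 𝒜) (subsets n) h (∈-subsets S)))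

  ratio-positive : ∀ {a b} → 0 ℕ.< a → a ℕ.< b → 0ℚ ℚ.< ratio a b
  ratio-positive {suc a} {suc b} _ _ = ℚₚ.positive⁻¹ _ {{ℚₚ.normalize-pos (suc a) (suc b)}}

  ratio-below-1 : ∀ {a b} → a ℕ.< b → ratio a b ℚ.< 1ℚ
  ratio-below-1 {a} {suc b} a<b = ℚₚ.toℚᵘ-cancel-<
    (ℚᵘₚ.<-respˡ-≃ (ℚᵘₚ.≃-sym (Auxiliary.toℚᵘ-/ (+ a) b)) (ℚᵘ.*<*
      (subst₂ ℤ._<_ (sym (ℤₚ.*-identityʳ (+ a))) (sym (ℤₚ.*-identityˡ (+ suc b))) (ℤ.+<+ a<b))))

module _ {n k : ℕ} {𝒜 : Family n k} {{proper : Proper 𝒜}} where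
  open Counting
  open Proper proper

  private
    q = ratio (card 𝒜) (n C k)

    0<q : 0ℚ ℚ.< q
    0<q = ratio-positive (card-positive 𝒜 ≉∅) (card-below 𝒜 ≉layer)

    q<1 : q ℚ.< 1ℚ
    q<1 = ratio-below-1 (card-below 𝒜 ≉layer)

    fromℚ-< : ∀ {x y : ℝ} p q → seq x ≡ (λ _ → p) → seq y ≡ (λ _ → q) → p ℚ.< q → x < y
    fromℚ-< {x} {y} p q eqx eqy p<q = record
      { gap = q ℚ.- p
      ; gap>0 = Auxiliary.p<q⇒0<q-p p<q
      ; from = 0
      ; separated = λ n _ → subst₂ (λ s t → s n ℚ.+ (q ℚ.- p) ℚ.≤ t n) (sym eqx) (sym eqy)
          (ℚₚ.≤-reflexive (solve 2 (λ p q → p :+ (q :- p) := q) refl p q))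
      }
      where
      open import Data.Rational.Solver
      open +-*-Solver

  instance
    μ-positive : 0ℝ < μ 𝒜
    μ-positive = fromℚ-< 0ℚ q refl refl 0<q

    μ-below-1 : μ 𝒜 < 1ℝ
    μ-below-1 = fromℚ-< q 1ℚ refl refl q<1

    1-μ-positive : 0ℝ < 1ℝ - μ 𝒜
    1-μ-positive = fromℚ-< 0ℚ (1ℚ ℚ.- q) refl refl (Auxiliary.p<q⇒0<q-p q<1)

    1-μ-below-1 : 1ℝ - μ 𝒜 < 1ℝ
    1-μ-below-1 = fromℚ-< (1ℚ ℚ.- q) 1ℚ refl refl
      (subst (1ℚ ℚ.- q ℚ.<_) (ℚₚ.+-identityʳ 1ℚ)
        (ℚₚ.+-monoʳ-< 1ℚ (ℚₚ.neg-antimono-< 0<q)))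

{-# OPTIONS --safe #-}

-- Call a set of size n/2 + r mixed if it lies in both shadows, and let β be the measure of the mixed
-- sets.  All n/2-subsets of an unmixed set lie on one side of the partition, and the two kinds of unmixed
-- sets are more than r swaps apart in the layer.  So there is a function f which is r on one kind, 0 on
-- the other, 1-Lipschitz for swaps, and constant along every swap between two unmixed sets.  The Poincaré
-- inequality on the slice, Var f ≤ n E g whenever (f B - f B′)² ≤ g B + g B′ for all swaps, applied to f
-- and to g = 1 on mixed sets, bounds r² times the product of the measures of the two kinds by n β.
-- By normalized matching the two shadows have measure at least μ 𝒜 and 1 - μ 𝒜, so that
-- r² μ(1 - μ) ≤ (n + r²) β.  This is stronger than the claim: the logarithm, being at least 3/4, only
-- weakens it, and the lower bound on n serves to exclude n = 2, where the layer n/2 + r can be empty.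
module Submission where

module Slice where

  open import Defs using (module Auxiliary; _⁻¹; leftSum; isqrt; sqrtApprox;
    Family; Member; member?; uniform; ∂⁺; _∩_; _ᶜ; subsets; card; ratio; module Counting)
  open Auxiliary using (*-mono-≤; *-nonNeg; *-pos; +-pos; 0<1; 0≤q-p⇒p≤q; p≤q⇒0≤q-p; square-nonNeg;
    toℚᵘ-/; ⁻¹-pos; ⁻¹-anti; ⁻¹-inverseʳ; leftSum-lower; isqrt-lower; isqrt-upper)
  open Counting using (count-map; count-none; card-layer)
  open import Level using (0ℓ)
  open import Data.Nat using (ℕ; zero; suc; z≤n; s≤s)
  import Data.Nat as ℕ
  import Data.Nat.Properties as ℕₚ
  open import Data.Nat.Combinatorics using (_C_)
  import Data.Integer as ℤ
  import Data.Integer.Properties as ℤₚ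
  open import Data.Rational
  open import Data.Rational.Properties
  import Data.Rational.Unnormalised as ℚᵘ
  import Data.Rational.Unnormalised.Properties as ℚᵘₚ
  open import Data.Rational.Solver
  open +-*-Solver using (solve; _:=_; _:+_; _:*_; _:-_; :-_; con)
  open import Data.Product using (Σ-syntax; ∃; _×_; _,_; proj₁; proj₂)
  open import Data.Sum using (_⊎_; inj₁; inj₂)
  open import Data.Fin.Subset using (Subset; inside; outside)
    renaming (∣_∣ to size; _⊆_ to _⊆ˢ_; _∩_ to _∩ˢ_)
  open import Data.Fin.Subset.Properties
    using (anySubset?; _⊆?_; ⊆-refl; ⊆-trans; p∩q⊆p; p∩q⊆q; out⊆; s⊆s; drop-∷-⊆)
  import Data.Vec as Vec
  open import Data.Vec using ([]; _∷_)
  open import Data.List using (List; map; filter; _++_; length) renaming ([] to []ˡ; _∷_ to _∷ˡ_)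
  import Data.List.Properties as Listₚ
  open import Function using (_∘_)
  open import Relation.Nullary using (¬_; Dec; yes; no; contradiction)
  open import Relation.Nullary.Decidable using (_×-dec_; ¬?)
  open import Relation.Unary using (Pred; Decidable)
  open import Relation.Binary.PropositionalEquality

  -- Order arithmetic, indicators and finite sums over the rationals

  cancel-≤ : ∀ {p q} r → 0ℚ < r → p * r ≤ q * r → p ≤ q
  cancel-≤ r 0<r = *-cancelʳ-≤-pos r {{positive 0<r}}

  *ˡ-mono : ∀ {p q} r → 0ℚ ≤ r → p ≤ q → r * p ≤ r * q
  *ˡ-mono r 0≤r = *-monoˡ-≤-nonNeg r {{nonNegative 0≤r}}

  *ʳ-mono : ∀ {p q} r → 0ℚ ≤ r → p ≤ q → p * r ≤ q * r
  *ʳ-mono r 0≤r = *-monoʳ-≤-nonNeg r {{nonNegative 0≤r}}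

  +-nonNeg : ∀ {p q} → 0ℚ ≤ p → 0ℚ ≤ q → 0ℚ ≤ p + q
  +-nonNeg 0≤p 0≤q = ≤-trans (≤-reflexive (sym (+-identityʳ 0ℚ))) (+-mono-≤ 0≤p 0≤q)

  +-cancelʳ-≤ : ∀ r {p q} → p + r ≤ q + r → p ≤ q
  +-cancelʳ-≤ r {p} {q} h = 0≤q-p⇒p≤q (subst (0ℚ ≤_)
    (solve 3 (λ p q r → (q :+ r) :- (p :+ r) := q :- p) refl p q r) (p≤q⇒0≤q-p h))

  ι : ℕ → ℚ
  ι n = ℤ.+ n / 1

  ι-suc : ∀ n → ι (suc n) ≡ 1ℚ + ι n
  ι-suc n = toℚᵘ-injective (ℚᵘₚ.≃-trans (toℚᵘ-/ (ℤ.+ suc n) 0) (ℚᵘₚ.≃-sym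
    (ℚᵘₚ.≃-trans (toℚᵘ-homo-+ 1ℚ (ι n))
      (ℚᵘₚ.≃-trans (ℚᵘₚ.+-congʳ (toℚᵘ 1ℚ) (toℚᵘ-/ (ℤ.+ n) 0))
        (ℚᵘ.*≡* (cong (ℤ._* ℤ.+ 1) (cong (ℤ._+_ (ℤ.+ 1)) (ℤₚ.*-identityʳ (ℤ.+ n)))))))))

  ι-+ : ∀ m n → ι (m ℕ.+ n) ≡ ι m + ι n
  ι-+ zero    n = sym (+-identityˡ (ι n))
  ι-+ (suc m) n = begin
    ι (suc (m ℕ.+ n))  ≡⟨ ι-suc (m ℕ.+ n) ⟩
    1ℚ + ι (m ℕ.+ n)   ≡⟨ cong (1ℚ +_) (ι-+ m n) ⟩
    1ℚ + (ι m + ι n)   ≡⟨ +-assoc 1ℚ (ι m) (ι n) ⟨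
    (1ℚ + ι m) + ι n   ≡⟨ cong (_+ ι n) (ι-suc m) ⟨
    ι (suc m) + ι n    ∎
    where open ≡-Reasoning

  ι-* : ∀ m n → ι (m ℕ.* n) ≡ ι m * ι n
  ι-* zero    n = sym (*-zeroˡ (ι n))
  ι-* (suc m) n = begin
    ι (n ℕ.+ m ℕ.* n)    ≡⟨ ι-+ n (m ℕ.* n) ⟩
    ι n + ι (m ℕ.* n)    ≡⟨ cong (ι n +_) (ι-* m n) ⟩
    ι n + ι m * ι n      ≡⟨ solve 2 (λ m n → n :+ m :* n := (con 1ℚ :+ m) :* n) refl (ι m) (ι n) ⟩
    (1ℚ + ι m) * ι n     ≡⟨ cong (_* ι n) (ι-suc m) ⟨
    ι (suc m) * ι n      ∎
    where open ≡-Reasoning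

  ι-nonNeg : ∀ n → 0ℚ ≤ ι n
  ι-nonNeg zero    = ≤-refl
  ι-nonNeg (suc n) = subst (0ℚ ≤_) (sym (ι-suc n)) (+-nonNeg (<⇒≤ 0<1) (ι-nonNeg n))

  ι-mono : ∀ {m n} → m ℕ.≤ n → ι m ≤ ι n
  ι-mono {n = n} z≤n = ι-nonNeg n
  ι-mono {suc m} {suc n} (s≤s m≤n) =
    subst₂ _≤_ (sym (ι-suc m)) (sym (ι-suc n)) (+-monoʳ-≤ 1ℚ (ι-mono m≤n))

  ι-pos : ∀ {n} → 0 ℕ.< n → 0ℚ < ι n
  ι-pos 0<n = <-≤-trans 0<1 (ι-mono 0<n)

  ι-cancel-< : ∀ {m n} → ι m < ι n → m ℕ.< n
  ι-cancel-< h = ℕₚ.≰⇒> λ n≤m → <-irrefl refl (<-≤-trans h (ι-mono n≤m))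

  ind : ∀ {P : Set} → Dec P → ℚ
  ind (yes _) = 1ℚ
  ind (no  _) = 0ℚ

  ind-yes : ∀ {P : Set} (P? : Dec P) → P → ind P? ≡ 1ℚ
  ind-yes (yes _) p = refl
  ind-yes (no ¬p) p = contradiction p ¬p

  ind-no : ∀ {P : Set} (P? : Dec P) → ¬ P → ind P? ≡ 0ℚ
  ind-no (yes p) ¬p = contradiction p ¬p
  ind-no (no _)  ¬p = refl

  ind-nonNeg : ∀ {P : Set} (P? : Dec P) → 0ℚ ≤ ind P?
  ind-nonNeg (yes _) = <⇒≤ 0<1
  ind-nonNeg (no _)  = ≤-refl

  ind≤1 : ∀ {P : Set} (P? : Dec P) → ind P? ≤ 1ℚ
  ind≤1 (yes _) = ≤-refl
  ind≤1 (no _)  = <⇒≤ 0<1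

  ind-mono : ∀ {P Q : Set} (P? : Dec P) (Q? : Dec Q) → (P → Q) → ind P? ≤ ind Q?
  ind-mono (yes p) Q? f = ≤-reflexive (sym (ind-yes Q? (f p)))
  ind-mono (no _)  Q? f = ind-nonNeg Q?

  ∑ : {X : Set} → List X → (X → ℚ) → ℚ
  ∑ []ˡ       φ = 0ℚ
  ∑ (x ∷ˡ xs) φ = φ x + ∑ xs φ

  module _ {X : Set} where

    ∑-cong : ∀ (xs : List X) {φ ψ : X → ℚ} → (∀ x → φ x ≡ ψ x) → ∑ xs φ ≡ ∑ xs ψ
    ∑-cong []ˡ       h = refl
    ∑-cong (x ∷ˡ xs) h = cong₂ _+_ (h x) (∑-cong xs h)

    ∑-mono : ∀ (xs : List X) {φ ψ : X → ℚ} → (∀ x → φ x ≤ ψ x) → ∑ xs φ ≤ ∑ xs ψ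
    ∑-mono []ˡ       h = ≤-refl
    ∑-mono (x ∷ˡ xs) h = +-mono-≤ (h x) (∑-mono xs h)

    ∑-nonNeg : ∀ (xs : List X) {φ : X → ℚ} → (∀ x → 0ℚ ≤ φ x) → 0ℚ ≤ ∑ xs φ
    ∑-nonNeg []ˡ       h = ≤-refl
    ∑-nonNeg (x ∷ˡ xs) h = +-nonNeg (h x) (∑-nonNeg xs h)

    ∑-++ : ∀ (xs ys : List X) φ → ∑ (xs ++ ys) φ ≡ ∑ xs φ + ∑ ys φ
    ∑-++ []ˡ       ys φ = sym (+-identityˡ (∑ ys φ))
    ∑-++ (x ∷ˡ xs) ys φ = trans (cong (φ x +_) (∑-++ xs ys φ))
      (sym (+-assoc (φ x) (∑ xs φ) (∑ ys φ)))

    ∑-map : ∀ {Y : Set} (h : Y → X) ys φ → ∑ (map h ys) φ ≡ ∑ ys (φ ∘ h)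
    ∑-map h []ˡ       φ = refl
    ∑-map h (y ∷ˡ ys) φ = cong (_+_ (φ (h y))) (∑-map h ys φ)

    ∑-+ : ∀ (xs : List X) φ ψ → ∑ xs (λ x → φ x + ψ x) ≡ ∑ xs φ + ∑ xs ψ
    ∑-+ []ˡ       φ ψ = sym (+-identityʳ 0ℚ)
    ∑-+ (x ∷ˡ xs) φ ψ = trans (cong (_+_ (φ x + ψ x)) (∑-+ xs φ ψ))
      (solve 4 (λ a b c d → (a :+ b) :+ (c :+ d) := (a :+ c) :+ (b :+ d)) refl
        (φ x) (ψ x) (∑ xs φ) (∑ xs ψ))

    ∑-*ˡ : ∀ (xs : List X) c φ → ∑ xs (λ x → c * φ x) ≡ c * ∑ xs φ
    ∑-*ˡ []ˡ       c φ = sym (*-zeroʳ c)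
    ∑-*ˡ (x ∷ˡ xs) c φ = trans (cong (_+_ (c * φ x)) (∑-*ˡ xs c φ))
      (sym (*-distribˡ-+ c (φ x) (∑ xs φ)))

    -- This expansion is the form in which Cauchy-Schwarz is used: when `d / c` is the mean of `φ`,
    -- the left side is a multiple of the variance.
    ∑-square : ∀ (xs : List X) c d φ →
      ∑ xs (λ x → (c * φ x - d) * (c * φ x - d)) ≡
      ((c * c) * ∑ xs (λ x → φ x * φ x) - ((c * d) + (c * d)) * ∑ xs φ) + (d * d) * ∑ xs (λ _ → 1ℚ)
    ∑-square []ˡ       c d φ = solve 2 (λ c d → con 0ℚ :=
      ((c :* c) :* con 0ℚ :- ((c :* d) :+ (c :* d)) :* con 0ℚ) :+ (d :* d) :* con 0ℚ) refl c d
    ∑-square (x ∷ˡ xs) c d φ = trans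
      (cong (_+_ ((c * φ x - d) * (c * φ x - d))) (∑-square xs c d φ))
      (solve 6 (λ c d y q s p →
        (c :* y :- d) :* (c :* y :- d) :+
          (((c :* c) :* q :- ((c :* d) :+ (c :* d)) :* s) :+ (d :* d) :* p) :=
        ((c :* c) :* (y :* y :+ q) :- ((c :* d) :+ (c :* d)) :* (y :+ s)) :+ (d :* d) :* (con 1ℚ :+ p))
        refl c d (φ x) (∑ xs (λ x → φ x * φ x)) (∑ xs φ) (∑ xs (λ _ → 1ℚ)))

  -- Layers and covering pairs

  infix 4 _⋖_

  -- The covering relation of the Boolean lattice, encoded by the position of the added element so
  -- that it splits along the first coordinate as the layers do.
  data _⋖_ : ∀ {n} → Subset n → Subset n → Set where
    here  : ∀ {n} {S : Subset n} → outside ∷ S ⋖ inside ∷ S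
    there : ∀ {n s} {M B : Subset n} → M ⋖ B → s ∷ M ⋖ s ∷ B

  Layer : ℕ → ℕ → Set
  Layer n k = Σ[ S ∈ Subset n ] size S ≡ k

  Cover : ℕ → ℕ → Set
  Cover n k = Σ[ M ∈ Subset n ] Σ[ B ∈ Subset n ] (size M ≡ k × M ⋖ B)

  out : ∀ {n k} → Layer n k → Layer (suc n) k
  out (S , p) = outside ∷ S , p

  inn : ∀ {n k} → Layer n k → Layer (suc n) (suc k)
  inn (S , p) = inside ∷ S , cong suc p

  outᶜ : ∀ {n k} → Cover n k → Cover (suc n) k
  outᶜ (M , B , p , h) = outside ∷ M , outside ∷ B , p , there h

  innᶜ : ∀ {n k} → Cover n k → Cover (suc n) (suc k)
  innᶜ (M , B , p , h) = inside ∷ M , inside ∷ B , cong suc p , there h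

  new : ∀ {n k} → Layer n k → Cover (suc n) k
  new (S , p) = outside ∷ S , inside ∷ S , p , here

  layers : ∀ n k → List (Layer n k)
  layers zero    zero    = ([] , refl) ∷ˡ []ˡ
  layers zero    (suc k) = []ˡ
  layers (suc n) zero    = map out (layers n zero)
  layers (suc n) (suc k) = map out (layers n (suc k)) ++ map inn (layers n k)

  -- Either both sets omit the first element, or both contain it, or it is the element added.
  covers : ∀ n k → List (Cover n k)
  covers zero    k       = []ˡ
  covers (suc n) zero    = map outᶜ (covers n zero) ++ map new (layers n zero)
  covers (suc n) (suc k) = (map outᶜ (covers n (suc k)) ++ map innᶜ (covers n k)) ++ map new (layers n (suc k))

  -- Summands are defined on all subsets, so that fixing the first coordinate is composition with
  -- `outside ∷_` or `inside ∷_`.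
  ∑ₗ : ∀ n k → (Subset n → ℚ) → ℚ
  ∑ₗ n k φ = ∑ (layers n k) (φ ∘ proj₁)

  ∑ᶜ : ∀ n k → (Subset n → Subset n → ℚ) → ℚ
  ∑ᶜ n k φ = ∑ (covers n k) (λ (M , B , _) → φ M B)

  ∑ₗ-suc-0 : ∀ n φ → ∑ₗ (suc n) 0 φ ≡ ∑ₗ n 0 (φ ∘ (outside ∷_))
  ∑ₗ-suc-0 n φ = ∑-map out (layers n 0) (φ ∘ proj₁)

  ∑ₗ-suc : ∀ n k φ → ∑ₗ (suc n) (suc k) φ ≡
    ∑ₗ n (suc k) (φ ∘ (outside ∷_)) + ∑ₗ n k (φ ∘ (inside ∷_))
  ∑ₗ-suc n k φ = trans (∑-++ (map out (layers n (suc k))) (map inn (layers n k)) (φ ∘ proj₁))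
    (cong₂ _+_ (∑-map out (layers n (suc k)) _) (∑-map inn (layers n k) _))

  ∑ᶜ-suc-0 : ∀ n φ → ∑ᶜ (suc n) 0 φ ≡
    ∑ᶜ n 0 (λ M B → φ (outside ∷ M) (outside ∷ B)) + ∑ₗ n 0 (λ S → φ (outside ∷ S) (inside ∷ S))
  ∑ᶜ-suc-0 n φ = trans (∑-++ (map outᶜ (covers n 0)) _ _)
    (cong₂ _+_ (∑-map outᶜ (covers n 0) _) (∑-map new (layers n 0) _))

  ∑ᶜ-suc : ∀ n k φ → ∑ᶜ (suc n) (suc k) φ ≡
    (∑ᶜ n (suc k) (λ M B → φ (outside ∷ M) (outside ∷ B)) +
     ∑ᶜ n k (λ M B → φ (inside ∷ M) (inside ∷ B))) +
    ∑ₗ n (suc k) (λ S → φ (outside ∷ S) (inside ∷ S))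
  ∑ᶜ-suc n k φ = trans (∑-++ (map outᶜ (covers n (suc k)) ++ map innᶜ (covers n k)) _ _)
    (cong₂ _+_ (trans (∑-++ (map outᶜ (covers n (suc k))) _ _)
      (cong₂ _+_ (∑-map outᶜ (covers n (suc k)) _) (∑-map innᶜ (covers n k) _)))
      (∑-map new (layers n (suc k)) _))

  -- Double counting: a `k`-set has `n - k` covers. For `k > n` the rational difference is negative,
  -- but the layer is empty.
  ∑ᶜ-lower : ∀ n k φ → ∑ᶜ n k (λ M _ → φ M) ≡ (ι n - ι k) * ∑ₗ n k φ
  ∑ᶜ-lower zero    zero    φ = sym (*-zeroˡ (φ [] + 0ℚ))
  ∑ᶜ-lower zero    (suc k) φ = sym (*-zeroʳ (0ℚ - ι (suc k)))
  ∑ᶜ-lower (suc n) zero    φ = begin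
    ∑ᶜ (suc n) 0 (λ M _ → φ M)                     ≡⟨ ∑ᶜ-suc-0 n (λ M _ → φ M) ⟩
    ∑ᶜ n 0 (λ M _ → φ (outside ∷ M)) + L           ≡⟨ cong (_+ L) (∑ᶜ-lower n 0 (φ ∘ (outside ∷_))) ⟩
    (ι n - 0ℚ) * L + L                             ≡⟨ solve 2 (λ n l → (n :- con 0ℚ) :* l :+ l
                                                        := ((con 1ℚ :+ n) :- con 0ℚ) :* l) refl (ι n) L ⟩
    ((1ℚ + ι n) - 0ℚ) * L                          ≡⟨ cong₂ (λ s t → (s - 0ℚ) * t) (ι-suc n) (∑ₗ-suc-0 n φ) ⟨
    (ι (suc n) - 0ℚ) * ∑ₗ (suc n) 0 φ              ∎
    where
    open ≡-Reasoning
    L = ∑ₗ n 0 (φ ∘ (outside ∷_))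
  ∑ᶜ-lower (suc n) (suc k) φ = begin
    ∑ᶜ (suc n) (suc k) (λ M _ → φ M)               ≡⟨ ∑ᶜ-suc n k (λ M _ → φ M) ⟩
    (∑ᶜ n (suc k) (λ M _ → φ (outside ∷ M)) + ∑ᶜ n k (λ M _ → φ (inside ∷ M))) + L₀
      ≡⟨ cong₂ (λ s t → (s + t) + L₀) (∑ᶜ-lower n (suc k) (φ ∘ (outside ∷_))) (∑ᶜ-lower n k (φ ∘ (inside ∷_))) ⟩
    ((ι n - ι (suc k)) * L₀ + (ι n - ι k) * L₁) + L₀
      ≡⟨ cong (λ t → ((ι n - t) * L₀ + (ι n - ι k) * L₁) + L₀) (ι-suc k) ⟩
    ((ι n - (1ℚ + ι k)) * L₀ + (ι n - ι k) * L₁) + L₀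
      ≡⟨ solve 4 (λ n k a b → ((n :- (con 1ℚ :+ k)) :* a :+ (n :- k) :* b) :+ a
           := ((con 1ℚ :+ n) :- (con 1ℚ :+ k)) :* (a :+ b)) refl (ι n) (ι k) L₀ L₁ ⟩
    ((1ℚ + ι n) - (1ℚ + ι k)) * (L₀ + L₁)
      ≡⟨ cong₂ (λ s t → (s - t) * (L₀ + L₁)) (ι-suc n) (ι-suc k) ⟨
    (ι (suc n) - ι (suc k)) * (L₀ + L₁)            ≡⟨ cong ((ι (suc n) - ι (suc k)) *_) (∑ₗ-suc n k φ) ⟨
    (ι (suc n) - ι (suc k)) * ∑ₗ (suc n) (suc k) φ ∎
    where
    open ≡-Reasoning
    L₀ = ∑ₗ n (suc k) (φ ∘ (outside ∷_))
    L₁ = ∑ₗ n k (φ ∘ (inside ∷_))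

  -- The count from above: a set of size `suc k` covers one set for each of its elements.
  ∑ᶜ-upper : ∀ n k φ → ∑ᶜ n k (λ _ B → φ B) ≡ ι (suc k) * ∑ₗ n (suc k) φ
  ∑ᶜ-upper zero    k       φ = sym (*-zeroʳ (ι (suc k)))
  ∑ᶜ-upper (suc n) zero    φ = begin
    ∑ᶜ (suc n) 0 (λ _ B → φ B)                     ≡⟨ ∑ᶜ-suc-0 n (λ _ B → φ B) ⟩
    ∑ᶜ n 0 (λ _ B → φ (outside ∷ B)) + L₁          ≡⟨ cong (_+ L₁) (∑ᶜ-upper n 0 (φ ∘ (outside ∷_))) ⟩
    1ℚ * L₀ + L₁                                   ≡⟨ solve 2 (λ a b → con 1ℚ :* a :+ b := con 1ℚ :* (a :+ b)) refl L₀ L₁ ⟩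
    1ℚ * (L₀ + L₁)                                 ≡⟨ cong (1ℚ *_) (∑ₗ-suc n 0 φ) ⟨
    1ℚ * ∑ₗ (suc n) 1 φ                            ∎
    where
    open ≡-Reasoning
    L₀ = ∑ₗ n 1 (φ ∘ (outside ∷_))
    L₁ = ∑ₗ n 0 (φ ∘ (inside ∷_))
  ∑ᶜ-upper (suc n) (suc k) φ = begin
    ∑ᶜ (suc n) (suc k) (λ _ B → φ B)               ≡⟨ ∑ᶜ-suc n k (λ _ B → φ B) ⟩
    (∑ᶜ n (suc k) (λ _ B → φ (outside ∷ B)) + ∑ᶜ n k (λ _ B → φ (inside ∷ B))) + L₁
      ≡⟨ cong₂ (λ s t → (s + t) + L₁) (∑ᶜ-upper n (suc k) (φ ∘ (outside ∷_))) (∑ᶜ-upper n k (φ ∘ (inside ∷_))) ⟩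
    (ι (suc (suc k)) * L₀ + ι (suc k) * L₁) + L₁
      ≡⟨ cong (λ t → (t * L₀ + ι (suc k) * L₁) + L₁) (ι-suc (suc k)) ⟩
    ((1ℚ + ι (suc k)) * L₀ + ι (suc k) * L₁) + L₁
      ≡⟨ solve 3 (λ k a b → ((con 1ℚ :+ k) :* a :+ k :* b) :+ b
           := (con 1ℚ :+ k) :* (a :+ b)) refl (ι (suc k)) L₀ L₁ ⟩
    (1ℚ + ι (suc k)) * (L₀ + L₁)                   ≡⟨ cong₂ _*_ (ι-suc (suc k)) (∑ₗ-suc n (suc k) φ) ⟨
    ι (suc (suc k)) * ∑ₗ (suc n) (suc (suc k)) φ   ∎
    where
    open ≡-Reasoning
    L₀ = ∑ₗ n (suc (suc k)) (φ ∘ (outside ∷_))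
    L₁ = ∑ₗ n (suc k) (φ ∘ (inside ∷_))

  ∑ₗ-empty : ∀ {n k} → n ℕ.< k → ∀ φ → ∑ₗ n k φ ≡ 0ℚ
  ∑ₗ-empty {zero}  {suc k} _ φ = refl
  ∑ₗ-empty {suc n} {suc k} (s≤s n<k) φ = trans (∑ₗ-suc n k φ)
    (trans (cong₂ _+_ (∑ₗ-empty (ℕₚ.m<n⇒m<1+n n<k) _) (∑ₗ-empty n<k _)) (+-identityʳ 0ℚ))

  -- The binomial coefficient, by `ι-C`, in a form that obeys the recursion of the sums.
  #ₗ : ℕ → ℕ → ℚ
  #ₗ n k = ∑ₗ n k (λ _ → 1ℚ)

  ∑ₗ-nonNeg : ∀ n k {φ} → (∀ S → 0ℚ ≤ φ S) → 0ℚ ≤ ∑ₗ n k φ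
  ∑ₗ-nonNeg n k h = ∑-nonNeg (layers n k) (λ (S , _) → h S)

  #ₗ-nonNeg : ∀ n k → 0ℚ ≤ #ₗ n k
  #ₗ-nonNeg n k = ∑ₗ-nonNeg n k λ _ → <⇒≤ 0<1

  #ₗ-pos : ∀ {n k} → k ℕ.≤ n → 0ℚ < #ₗ n k
  #ₗ-pos {zero}  {zero}  _ = positive⁻¹ (#ₗ 0 0)
  #ₗ-pos {suc n} {zero}  _ = subst (0ℚ <_) (sym (∑ₗ-suc-0 n _)) (#ₗ-pos {n} z≤n)
  #ₗ-pos {suc n} {suc k} (s≤s k≤n) = subst (0ℚ <_) (sym (∑ₗ-suc n k _))
    (+-mono-≤-< (#ₗ-nonNeg n (suc k)) (#ₗ-pos k≤n))

  -- The Poincaré inequality and normalized matching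

  ∑-- : ∀ {X : Set} (xs : List X) φ ψ → ∑ xs (λ x → φ x - ψ x) ≡ ∑ xs φ - ∑ xs ψ
  ∑-- []ˡ       φ ψ = refl
  ∑-- (x ∷ˡ xs) φ ψ = trans (cong ((φ x - ψ x) +_) (∑-- xs φ ψ))
    (solve 4 (λ a b c d → (a :- b) :+ (c :- d) := (a :+ c) :- (b :+ d)) refl
      (φ x) (ψ x) (∑ xs φ) (∑ xs ψ))

  ι-gap-pos : ∀ {m n} → m ℕ.< n → 0ℚ < ι n - ι m
  ι-gap-pos {m} {n} m<n = <-≤-trans 0<1 (subst₂ _≤_
    (solve 1 (λ m → (con 1ℚ :+ m) :- m := con 1ℚ) refl (ι m)) refl
    (+-monoˡ-≤ (- ι m) (subst (_≤ ι n) (ι-suc m) (ι-mono m<n))))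

  -- The covering pairs M ⋖ B couple the uniform measures of two adjacent layers; the bound is Cauchy–Schwarz
  -- for f₀ B - f₁ M under this coupling, with denominators cleared.
  mean-gap : ∀ {n k} → k ℕ.< n → ∀ f₁ f₀ g₁ g₀ →
    (∀ {M B} → size M ≡ k → M ⋖ B → (f₀ B - f₁ M) * (f₀ B - f₁ M) ≤ g₁ M + g₀ B) →
    let N₁ = #ₗ n k
        N₀ = #ₗ n (suc k)
        D = N₁ * ∑ₗ n (suc k) f₀ - N₀ * ∑ₗ n k f₁
    in D * D ≤ (N₁ * N₀) * (N₀ * ∑ₗ n k g₁ + N₁ * ∑ₗ n (suc k) g₀)
  mean-gap {n} {k} k<n f₁ f₀ g₁ g₀ h = cancel-≤ P 0<P (0≤q-p⇒p≤q (begin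
    -- Under the uniform measure on covering pairs, `f₀ B - f₁ M` has mean `D / c`; the sum below is
    -- its variance times `c * c * P`.
    0ℚ
      ≤⟨ ∑-nonNeg (covers n k) (λ (M , B , _) → square-nonNeg (c * (f₀ B - f₁ M) - D)) ⟩
    ∑ᶜ n k (λ M B → (c * (f₀ B - f₁ M) - D) * (c * (f₀ B - f₁ M) - D))
      ≡⟨ ∑-square (covers n k) c D (λ (M , B , _) → f₀ B - f₁ M) ⟩
    ((c * c) * Q - (c * D + c * D) * ∑ᶜ n k (λ M B → f₀ B - f₁ M)) + (D * D) * P
      ≤⟨ +-monoˡ-≤ ((D * D) * P) (+-monoˡ-≤ (- ((c * D + c * D) * ∑ᶜ n k (λ M B → f₀ B - f₁ M)))
           (*ˡ-mono (c * c) (square-nonNeg c) Q≤)) ⟩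
    ((c * c) * (α * G₁ + κ * G₀) - (c * D + c * D) * ∑ᶜ n k (λ M B → f₀ B - f₁ M)) + (D * D) * P
      ≡⟨ cong (λ t → ((c * c) * (α * G₁ + κ * G₀) - (c * D + c * D) * t) + (D * D) * P) X≡ ⟩
    ((c * c) * (α * G₁ + κ * G₀) - (c * D + c * D) * (κ * S₀ - α * S₁)) + (D * D) * P
      ≡⟨ solve 11 (λ α κ N₁ N₀ S₁ S₀ G₁ G₀ c D P →
           ((c :* c) :* (α :* G₁ :+ κ :* G₀) :- (c :* D :+ c :* D) :* (κ :* S₀ :- α :* S₁)) :+ (D :* D) :* P
           := (c :* ((c :* α) :* G₁ :+ (c :* κ) :* G₀)
                 :- (D :+ D) :* ((c :* κ) :* S₀ :- (c :* α) :* S₁)) :+ (D :* D) :* P) refl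
           α κ N₁ N₀ S₁ S₀ G₁ G₀ c D P ⟩
    (c * ((c * α) * G₁ + (c * κ) * G₀) - (D + D) * ((c * κ) * S₀ - (c * α) * S₁)) + (D * D) * P
      ≡⟨ cong₂ (λ s t → (c * (s * G₁ + t * G₀) - (D + D) * (t * S₀ - s * S₁)) + (D * D) * P) cα cκ ⟩
    (c * ((N₀ * P) * G₁ + (N₁ * P) * G₀) - (D + D) * ((N₁ * P) * S₀ - (N₀ * P) * S₁)) + (D * D) * P
      ≡⟨ solve 8 (λ N₁ N₀ S₁ S₀ G₁ G₀ c P →
           (c :* ((N₀ :* P) :* G₁ :+ (N₁ :* P) :* G₀)
             :- ((N₁ :* S₀ :- N₀ :* S₁) :+ (N₁ :* S₀ :- N₀ :* S₁)) :* ((N₁ :* P) :* S₀ :- (N₀ :* P) :* S₁))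
             :+ ((N₁ :* S₀ :- N₀ :* S₁) :* (N₁ :* S₀ :- N₀ :* S₁)) :* P
           := (c :* (N₀ :* G₁ :+ N₁ :* G₀)) :* P :- ((N₁ :* S₀ :- N₀ :* S₁) :* (N₁ :* S₀ :- N₀ :* S₁)) :* P)
           refl N₁ N₀ S₁ S₀ G₁ G₀ c P ⟩
    (c * (N₀ * G₁ + N₁ * G₀)) * P - (D * D) * P ∎))
    where
    open ≤-Reasoning
    α = ι n - ι k
    κ = ι (suc k)
    N₁ = #ₗ n k
    N₀ = #ₗ n (suc k)
    S₁ = ∑ₗ n k f₁
    S₀ = ∑ₗ n (suc k) f₀
    G₁ = ∑ₗ n k g₁
    G₀ = ∑ₗ n (suc k) g₀
    c = N₁ * N₀
    D = N₁ * S₀ - N₀ * S₁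
    P = ∑ᶜ n k (λ _ _ → 1ℚ)
    Q = ∑ᶜ n k (λ M B → (f₀ B - f₁ M) * (f₀ B - f₁ M))
    P≡αN₁ : P ≡ α * N₁
    P≡αN₁ = ∑ᶜ-lower n k (λ _ → 1ℚ)
    P≡κN₀ : P ≡ κ * N₀
    P≡κN₀ = ∑ᶜ-upper n k (λ _ → 1ℚ)
    0<P : 0ℚ < P
    0<P = subst (0ℚ <_) (sym P≡αN₁) (*-pos (ι-gap-pos k<n) (#ₗ-pos (ℕₚ.<⇒≤ k<n)))
    -- The number `P` of pairs is `α * N₁` counted from below and `κ * N₀` from above, which trades
    -- degrees for layer sizes without division.
    cα : c * α ≡ N₀ * P
    cα = trans (solve 3 (λ a b c → (a :* b) :* c := b :* (c :* a)) refl N₁ N₀ α) (cong (N₀ *_) (sym P≡αN₁))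
    cκ : c * κ ≡ N₁ * P
    cκ = trans (solve 3 (λ a b c → (a :* b) :* c := a :* (c :* b)) refl N₁ N₀ κ) (cong (N₁ *_) (sym P≡κN₀))
    X≡ : ∑ᶜ n k (λ M B → f₀ B - f₁ M) ≡ κ * S₀ - α * S₁
    X≡ = trans (∑-- (covers n k) (λ (_ , B , _) → f₀ B) (λ (M , _) → f₁ M))
      (cong₂ _-_ (∑ᶜ-upper n k f₀) (∑ᶜ-lower n k f₁))
    Q≤ : Q ≤ α * G₁ + κ * G₀
    Q≤ = ≤-trans (∑-mono (covers n k) (λ (_ , _ , p , M⋖B) → h p M⋖B))
      (≤-reflexive (trans (∑-+ (covers n k) (λ (M , _) → g₁ M) (λ (_ , B , _) → g₀ B))
        (cong₂ _+_ (∑ᶜ-lower n k g₁) (∑ᶜ-upper n k g₀))))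

  -- Conditioning on the first coordinate splits the layer into layers k and k + 1 of the smaller cube, on
  -- which mean-gap bounds the difference of the means; this contributes at most one further ∑ g.
  poincaré : ∀ n k f g → (∀ S → 0ℚ ≤ g S) →
    (∀ {M B B′} → suc (size M) ≡ k → M ⋖ B → M ⋖ B′ → (f B - f B′) * (f B - f B′) ≤ g B + g B′) →
    #ₗ n k * ∑ₗ n k (λ S → f S * f S) - ∑ₗ n k f * ∑ₗ n k f ≤ ι n * (#ₗ n k * ∑ₗ n k g)
  poincaré zero zero f g 0≤g h = ≤-reflexive
    (solve 2 (λ a b → (con 1ℚ :+ con 0ℚ) :* (a :* a :+ con 0ℚ) :- (a :+ con 0ℚ) :* (a :+ con 0ℚ)
      := con 0ℚ :* ((con 1ℚ :+ con 0ℚ) :* (b :+ con 0ℚ))) refl (f []) (g []))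
  poincaré zero (suc k) f g 0≤g h = ≤-refl
  poincaré (suc n) zero f g 0≤g h
    rewrite ∑ₗ-suc-0 n (λ _ → 1ℚ) | ∑ₗ-suc-0 n (λ S → f S * f S) | ∑ₗ-suc-0 n f | ∑ₗ-suc-0 n g = ≤-trans
    (poincaré n zero (f ∘ (outside ∷_)) (g ∘ (outside ∷_)) (0≤g ∘ (outside ∷_)) λ ())
    (*ʳ-mono _ (*-nonNeg (#ₗ-nonNeg n 0) (∑ₗ-nonNeg n 0 (0≤g ∘ (outside ∷_)))) (ι-mono (ℕₚ.n≤1+n n)))
  poincaré (suc n) (suc k) f g 0≤g h
    rewrite ∑ₗ-suc n k (λ _ → 1ℚ) | ∑ₗ-suc n k (λ S → f S * f S) | ∑ₗ-suc n k f | ∑ₗ-suc n k g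
    with suc k ℕ.≤? n | poincaré n k (f ∘ (inside ∷_)) (g ∘ (inside ∷_)) (0≤g ∘ (inside ∷_))
                          (λ p a b → h (cong suc p) (there a) (there b))
  -- Layer `suc k` of the smaller cube is empty, so every set of the layer contains the first
  -- element and one induction hypothesis suffices.
  ... | no  k≮n | ih₁
    rewrite ∑ₗ-empty (ℕₚ.≰⇒> k≮n) (λ _ → 1ℚ) | ∑ₗ-empty (ℕₚ.≰⇒> k≮n) (λ S → f (outside ∷ S) * f (outside ∷ S))
          | ∑ₗ-empty (ℕₚ.≰⇒> k≮n) (f ∘ (outside ∷_)) | ∑ₗ-empty (ℕₚ.≰⇒> k≮n) (g ∘ (outside ∷_))
          | +-identityˡ (#ₗ n k) | +-identityˡ (∑ₗ n k (λ S → f (inside ∷ S) * f (inside ∷ S)))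
          | +-identityˡ (∑ₗ n k (f ∘ (inside ∷_))) | +-identityˡ (∑ₗ n k (g ∘ (inside ∷_))) = ≤-trans ih₁
    (*ʳ-mono _ (*-nonNeg (#ₗ-nonNeg n k) (∑ₗ-nonNeg n k (0≤g ∘ (inside ∷_)))) (ι-mono (ℕₚ.n≤1+n n)))
  -- Scaled by `N₁ * N₀`, the slack is a nonnegative combination of the slacks of both induction
  -- hypotheses and of `gap`, plus a nonnegative term in `G₁` and `G₀`.
  ... | yes k<n | ih₁ = cancel-≤ (N₁ * N₀) (*-pos 0<N₁ 0<N₀) (0≤q-p⇒p≤q (subst (0ℚ ≤_)
    (trans (solve 9 (λ n N₁ N₀ S₁ S₀ Q₁ Q₀ G₁ G₀ →
      (((N₁ :+ N₀) :* N₀) :* (n :* (N₁ :* G₁) :- (N₁ :* Q₁ :- S₁ :* S₁))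
        :+ ((N₁ :+ N₀) :* N₁) :* (n :* (N₀ :* G₀) :- (N₀ :* Q₀ :- S₀ :* S₀)))
      :+ (((N₁ :* N₀) :* (N₀ :* G₁ :+ N₁ :* G₀)
           :- (N₁ :* S₀ :- N₀ :* S₁) :* (N₁ :* S₀ :- N₀ :* S₁))
        :+ (N₁ :* N₀) :* (N₁ :* G₁ :+ N₀ :* G₀))
      := ((con 1ℚ :+ n) :* ((N₀ :+ N₁) :* (G₀ :+ G₁))) :* (N₁ :* N₀)
         :- ((N₀ :+ N₁) :* (Q₀ :+ Q₁) :- (S₀ :+ S₁) :* (S₀ :+ S₁)) :* (N₁ :* N₀))
      refl (ι n) N₁ N₀ S₁ S₀ Q₁ Q₀ G₁ G₀)
      (cong (λ t → (t * ((N₀ + N₁) * (G₀ + G₁))) * (N₁ * N₀)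
         - ((N₀ + N₁) * (Q₀ + Q₁) - (S₀ + S₁) * (S₀ + S₁)) * (N₁ * N₀)) (sym (ι-suc n))))
    (+-nonNeg
      (+-nonNeg (*-nonNeg (*-nonNeg 0≤N (<⇒≤ 0<N₀)) (p≤q⇒0≤q-p ih₁))
                (*-nonNeg (*-nonNeg 0≤N (<⇒≤ 0<N₁)) (p≤q⇒0≤q-p ih₀)))
      (+-nonNeg (p≤q⇒0≤q-p gap)
                (*-nonNeg (<⇒≤ (*-pos 0<N₁ 0<N₀)) (+-nonNeg (*-nonNeg (<⇒≤ 0<N₁) 0≤G₁) (*-nonNeg (<⇒≤ 0<N₀) 0≤G₀)))))))
    where
    f₁ = f ∘ (inside ∷_)
    f₀ = f ∘ (outside ∷_)
    g₁ = g ∘ (inside ∷_)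
    g₀ = g ∘ (outside ∷_)
    N₁ = #ₗ n k
    N₀ = #ₗ n (suc k)
    S₁ = ∑ₗ n k f₁
    S₀ = ∑ₗ n (suc k) f₀
    Q₁ = ∑ₗ n k (λ S → f₁ S * f₁ S)
    Q₀ = ∑ₗ n (suc k) (λ S → f₀ S * f₀ S)
    G₁ = ∑ₗ n k g₁
    G₀ = ∑ₗ n (suc k) g₀
    0<N₁ : 0ℚ < N₁
    0<N₁ = #ₗ-pos (ℕₚ.<⇒≤ k<n)
    0<N₀ : 0ℚ < N₀
    0<N₀ = #ₗ-pos k<n
    0≤N : 0ℚ ≤ N₁ + N₀
    0≤N = <⇒≤ (+-pos 0<N₁ 0<N₀)
    0≤G₁ : 0ℚ ≤ G₁
    0≤G₁ = ∑ₗ-nonNeg n k (0≤g ∘ (inside ∷_))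
    0≤G₀ : 0ℚ ≤ G₀
    0≤G₀ = ∑ₗ-nonNeg n (suc k) (0≤g ∘ (outside ∷_))
    ih₀ = poincaré n (suc k) f₀ g₀ (0≤g ∘ (outside ∷_)) (λ p a b → h p (there a) (there b))
    -- Both `inside ∷ M` and `outside ∷ B` cover `outside ∷ M`, so a covering pair of the smaller
    -- cube is a swap involving the first element.
    gap = mean-gap k<n f₁ f₀ g₁ g₀ λ {M} {B} p M⋖B → subst₂ _≤_
      (solve 2 (λ a b → (a :- b) :* (a :- b) := (b :- a) :* (b :- a)) refl (f₁ M) (f₀ B)) refl
      (h (cong suc p) here (there M⋖B))

  -- Summing `φ M ≤ φ B` over covering pairs weights lower sets by `α` and upper sets by `κ`; the
  -- two counts of the pairs turn these weights into layer sizes.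
  normalized-matching-step : ∀ {n k} φ → k ℕ.< n → (∀ {M B} → M ⋖ B → φ M ≤ φ B) →
    ∑ₗ n k φ * #ₗ n (suc k) ≤ ∑ₗ n (suc k) φ * #ₗ n k
  normalized-matching-step {n} {k} φ k<n mono = cancel-≤ κ (ι-pos {suc k} (s≤s z≤n)) (begin
    (S * N′) * κ  ≡⟨ solve 3 (λ s n k → (s :* n) :* k := s :* (k :* n)) refl S N′ κ ⟩
    S * (κ * N′)  ≡⟨ cong (S *_) (trans (sym (∑ᶜ-upper n k (λ _ → 1ℚ))) (∑ᶜ-lower n k (λ _ → 1ℚ))) ⟩
    S * (α * N)   ≡⟨ solve 3 (λ s n k → s :* (k :* n) := (k :* s) :* n) refl S N α ⟩
    (α * S) * N   ≤⟨ *ʳ-mono N (#ₗ-nonNeg n k) (subst₂ _≤_ (∑ᶜ-lower n k φ) (∑ᶜ-upper n k φ)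
                       (∑-mono (covers n k) (λ (_ , _ , _ , M⋖B) → mono M⋖B))) ⟩
    (κ * S′) * N  ≡⟨ solve 3 (λ s n k → (k :* s) :* n := (s :* n) :* k) refl S′ N κ ⟩
    (S′ * N) * κ  ∎)
    where
    open ≤-Reasoning
    α = ι n - ι k
    κ = ι (suc k)
    S = ∑ₗ n k φ
    S′ = ∑ₗ n (suc k) φ
    N = #ₗ n k
    N′ = #ₗ n (suc k)

  normalized-matching : ∀ {n k} φ r → k ℕ.+ r ℕ.≤ n → (∀ {M B} → M ⋖ B → φ M ≤ φ B) →
    ∑ₗ n k φ * #ₗ n (k ℕ.+ r) ≤ ∑ₗ n (k ℕ.+ r) φ * #ₗ n k
  normalized-matching {k = k} φ zero _ mono rewrite ℕₚ.+-identityʳ k = ≤-refl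
  normalized-matching {n} {k} φ (suc r) k+r<n mono rewrite ℕₚ.+-suc k r =
    cancel-≤ K (#ₗ-pos (ℕₚ.<⇒≤ k+r<n)) (begin
    (S * N″) * K   ≡⟨ solve 3 (λ a b c → (a :* b) :* c := (a :* c) :* b) refl S N″ K ⟩
    (S * K) * N″   ≤⟨ *ʳ-mono N″ (#ₗ-nonNeg n (suc (k ℕ.+ r))) (normalized-matching φ r (ℕₚ.<⇒≤ k+r<n) mono) ⟩
    (S′ * N) * N″  ≡⟨ solve 3 (λ a b c → (a :* b) :* c := (a :* c) :* b) refl S′ N N″ ⟩
    (S′ * N″) * N  ≤⟨ *ʳ-mono N (#ₗ-nonNeg n k) (normalized-matching-step φ k+r<n mono) ⟩
    (S″ * K) * N   ≡⟨ solve 3 (λ a b c → (a :* b) :* c := (a :* c) :* b) refl S″ K N ⟩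
    (S″ * N) * K   ∎)
    where
    open ≤-Reasoning
    S = ∑ₗ n k φ
    S′ = ∑ₗ n (k ℕ.+ r) φ
    S″ = ∑ₗ n (suc (k ℕ.+ r)) φ
    N = #ₗ n k
    K = #ₗ n (k ℕ.+ r)
    N″ = #ₗ n (suc (k ℕ.+ r))

  -- Subsets, cardinalities and measures

  ⋖⇒⊆ : ∀ {n} {M B : Subset n} → M ⋖ B → M ⊆ˢ B
  ⋖⇒⊆ here        = out⊆ ⊆-refl
  ⋖⇒⊆ (there M⋖B) = s⊆s (⋖⇒⊆ M⋖B)

  ⋖⇒size : ∀ {n} {M B : Subset n} → M ⋖ B → size B ≡ suc (size M)
  ⋖⇒size here                        = refl
  ⋖⇒size (there {s = outside} M⋖B) = ⋖⇒size M⋖B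
  ⋖⇒size (there {s = inside}  M⋖B) = cong suc (⋖⇒size M⋖B)

  size-∩-⋖ : ∀ {n} {M B : Subset n} S → M ⋖ B → size (S ∩ˢ B) ℕ.≤ suc (size (S ∩ˢ M))
  size-∩-⋖ (outside ∷ S) here                       = ℕₚ.n≤1+n _
  size-∩-⋖ (inside  ∷ S) here                       = ℕₚ.≤-refl
  size-∩-⋖ (outside ∷ S) (there M⋖B)                = size-∩-⋖ S M⋖B
  size-∩-⋖ (inside  ∷ S) (there {s = outside} M⋖B) = size-∩-⋖ S M⋖B
  size-∩-⋖ (inside  ∷ S) (there {s = inside}  M⋖B) = s≤s (size-∩-⋖ S M⋖B)

  ⊆⇒∩≡ : ∀ {n} {M B : Subset n} → M ⊆ˢ B → M ∩ˢ B ≡ M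
  ⊆⇒∩≡ {M = []}          {[]}          _   = refl
  ⊆⇒∩≡ {M = outside ∷ M} {b ∷ B}       M⊆B = cong (outside ∷_) (⊆⇒∩≡ (drop-∷-⊆ M⊆B))
  ⊆⇒∩≡ {M = inside ∷ M}  {inside ∷ B}  M⊆B = cong (inside ∷_) (⊆⇒∩≡ (drop-∷-⊆ M⊆B))
  ⊆⇒∩≡ {M = inside ∷ M}  {outside ∷ B} M⊆B with M⊆B Vec.here
  ... | ()

  subset-of-size : ∀ {n} k (M : Subset n) → k ℕ.≤ size M → ∃ λ S → size S ≡ k × S ⊆ˢ M
  subset-of-size zero    []            _ = [] , refl , ⊆-refl
  subset-of-size k       (outside ∷ M) h with subset-of-size k M h
  ... | S , p , S⊆M = outside ∷ S , p , s⊆s S⊆M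
  subset-of-size zero    (inside ∷ M)  h with subset-of-size zero M z≤n
  ... | S , p , S⊆M = outside ∷ S , p , out⊆ S⊆M
  subset-of-size (suc k) (inside ∷ M)  (s≤s h) with subset-of-size k M h
  ... | S , p , S⊆M = inside ∷ S , cong suc p , s⊆s S⊆M

  -- This links `card`, which filters all subsets, to sums over one layer; the hypothesis on sizes
  -- ensures that nothing outside the layer is counted.
  ∑ₗ-ind : ∀ n k {P : Pred (Subset n) 0ℓ} (P? : Decidable P) → (∀ S → P S → size S ≡ k) →
    ι (length (filter P? (subsets n))) ≡ ∑ₗ n k (ind ∘ P?)
  ∑ₗ-ind zero    zero    P? h with P? []
  ... | yes _ = refl
  ... | no  _ = refl
  ∑ₗ-ind zero    (suc k) P? h with P? []
  ... | yes p = contradiction (h [] p) λ ()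
  ... | no  _ = refl
  ∑ₗ-ind (suc n) k {P} P? h = begin
    ι (length (filter P? (l₀ ++ l₁)))
      ≡⟨ cong (ι ∘ length) (Listₚ.filter-++ P? l₀ l₁) ⟩
    ι (length (filter P? l₀ ++ filter P? l₁))
      ≡⟨ cong ι (Listₚ.length-++ (filter P? l₀)) ⟩
    ι (length (filter P? l₀) ℕ.+ length (filter P? l₁))
      ≡⟨ ι-+ (length (filter P? l₀)) (length (filter P? l₁)) ⟩
    ι (length (filter P? l₀)) + ι (length (filter P? l₁))
      ≡⟨ cong₂ (λ s t → ι s + ι t) (count-map P? (outside ∷_) (subsets n)) (count-map P? (inside ∷_) (subsets n)) ⟩
    ι (length (filter (P? ∘ (outside ∷_)) (subsets n))) + ι (length (filter (P? ∘ (inside ∷_)) (subsets n)))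
      ≡⟨ split k h ⟩
    ∑ₗ (suc n) k (ind ∘ P?) ∎
    where
    open ≡-Reasoning
    l₀ = map (outside ∷_) (subsets n)
    l₁ = map (inside ∷_) (subsets n)
    split : ∀ k → (∀ S → P S → size S ≡ k) →
      ι (length (filter (P? ∘ (outside ∷_)) (subsets n))) + ι (length (filter (P? ∘ (inside ∷_)) (subsets n)))
      ≡ ∑ₗ (suc n) k (ind ∘ P?)
    split zero h = begin
      _ ≡⟨ cong₂ (λ s t → s + ι t) (∑ₗ-ind n 0 (P? ∘ (outside ∷_)) (λ S → h (outside ∷ S)))
             (count-none (P? ∘ (inside ∷_)) (λ S p → contradiction (h (inside ∷ S) p) λ ()) (subsets n)) ⟩
      _ ≡⟨ +-identityʳ _ ⟩
      _ ≡⟨ ∑ₗ-suc-0 n (ind ∘ P?) ⟨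
      _ ∎
    split (suc k) h = trans
      (cong₂ _+_ (∑ₗ-ind n (suc k) (P? ∘ (outside ∷_)) (λ S → h (outside ∷ S)))
                 (∑ₗ-ind n k (P? ∘ (inside ∷_)) (λ S p → ℕₚ.suc-injective (h (inside ∷ S) p))))
      (sym (∑ₗ-suc n k (ind ∘ P?)))

  ι-card : ∀ {n k} (ℱ : Family n k) → ι (card ℱ) ≡ ∑ₗ n k (ind ∘ member? ℱ)
  ι-card {n} {k} ℱ = ∑ₗ-ind n k (member? ℱ) (λ _ → uniform ℱ)

  ι-C : ∀ n k → ι (n C k) ≡ #ₗ n k
  ι-C n k = trans (cong ι (sym (card-layer n k))) (trans (∑ₗ-ind n k (λ S → size S ℕ.≟ k) λ _ p → p)
    (∑-cong (layers n k) λ (S , p) → ind-yes (size S ℕ.≟ k) p))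

  ratio-cancel : ∀ a b → 0ℚ < ι b → ratio a b * ι b ≡ ι a
  -- Positivity of `ι b` rules out the default value of `ratio` at denominator zero.
  ratio-cancel a zero   0<b = contradiction refl (<⇒≢ 0<b)
  ratio-cancel a (suc b) _   = toℚᵘ-injective (ℚᵘₚ.≃-trans (toℚᵘ-homo-* (ℤ.+ a / suc b) (ι (suc b)))
    (ℚᵘₚ.≃-trans (ℚᵘₚ.*-cong (toℚᵘ-/ (ℤ.+ a) b) (toℚᵘ-/ (ℤ.+ suc b) 0))
      (ℚᵘₚ.≃-trans (ℚᵘ.*≡* (trans (ℤₚ.*-identityʳ _) (cong (λ t → ℤ.+ a ℤ.* ℤ.+ t) (sym (ℕₚ.*-identityʳ (suc b))))))
        (ℚᵘₚ.≃-sym (toℚᵘ-/ (ℤ.+ a) 0)))))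

  -- Variance as a sum over ordered pairs

  ∑-quadratic : ∀ {X : Set} (xs : List X) f u v a b c d e →
    ∑ xs (λ x → (((a + b * f x) + c * (f x * f x)) + d * u x) + e * v x) ≡
    (((a * ∑ xs (λ _ → 1ℚ) + b * ∑ xs f) + c * ∑ xs (λ x → f x * f x)) + d * ∑ xs u) + e * ∑ xs v
  ∑-quadratic []ˡ       f u v a b c d e = solve 5 (λ a b c d e →
    con 0ℚ := (((a :* con 0ℚ :+ b :* con 0ℚ) :+ c :* con 0ℚ) :+ d :* con 0ℚ) :+ e :* con 0ℚ) refl a b c d e
  ∑-quadratic (x ∷ˡ xs) f u v a b c d e = trans
    (cong (((((a + b * f x) + c * (f x * f x)) + d * u x) + e * v x) +_) (∑-quadratic xs f u v a b c d e))
    (solve 13 (λ a b c d e y w z N S Q U V →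
      ((((a :+ b :* y) :+ c :* (y :* y)) :+ d :* w) :+ e :* z) :+
        ((((a :* N :+ b :* S) :+ c :* Q) :+ d :* U) :+ e :* V) :=
      (((a :* (con 1ℚ :+ N) :+ b :* (y :+ S)) :+ c :* (y :* y :+ Q)) :+ d :* (w :+ U)) :+ e :* (z :+ V)) refl
      a b c d e (f x) (u x) (v x) (∑ xs (λ _ → 1ℚ)) (∑ xs f) (∑ xs (λ x → f x * f x)) (∑ xs u) (∑ xs v))

  -- Sum the hypothesis over all ordered pairs: the right side becomes twice the variance.
  variance-lower : ∀ {X : Set} (xs : List X) R f u v →
    (∀ x y → R * (u x * v y + v x * u y) ≤ (f y - f x) * (f y - f x)) →
    R * (∑ xs u * ∑ xs v) ≤ ∑ xs (λ _ → 1ℚ) * ∑ xs (λ x → f x * f x) - ∑ xs f * ∑ xs f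
  variance-lower xs R f u v h = cancel-≤ (1ℚ + 1ℚ) (+-pos 0<1 0<1) (0≤q-p⇒p≤q (subst (0ℚ ≤_)
    (trans (∑-quadratic xs f u v Q (- (S + S)) N (- (R * V)) (- (R * U)))
      (solve 6 (λ R N S Q U V →
        (((Q :* N :+ (:- (S :+ S)) :* S) :+ N :* Q) :+ (:- (R :* V)) :* U) :+ (:- (R :* U)) :* V
        := (N :* Q :- S :* S) :* (con 1ℚ :+ con 1ℚ) :- (R :* (U :* V)) :* (con 1ℚ :+ con 1ℚ))
        refl R N S Q U V))
    (∑-nonNeg xs λ x → subst (0ℚ ≤_)
      (trans (∑-quadratic xs f u v (f x * f x) (- (f x + f x)) 1ℚ (- (R * v x)) (- (R * u x)))
        (solve 9 (λ R N S Q U V y w z →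
          ((((y :* y) :* N :+ (:- (y :+ y)) :* S) :+ con 1ℚ :* Q) :+ (:- (R :* z)) :* U) :+ (:- (R :* w)) :* V
          := (((Q :+ (:- (S :+ S)) :* y) :+ N :* (y :* y)) :+ (:- (R :* V)) :* w) :+ (:- (R :* U)) :* z)
          refl R N S Q U V (f x) (u x) (v x)))
      -- The inner sum fixes `x` and runs over `y`; both it and the outer sum have the shape of
      -- `∑-quadratic`.
      (∑-nonNeg xs λ y → subst (0ℚ ≤_)
        (solve 7 (λ R s t w z w′ z′ →
          (t :- s) :* (t :- s) :- R :* (w :* z′ :+ z :* w′)
          := (((s :* s :+ (:- (s :+ s)) :* t) :+ con 1ℚ :* (t :* t)) :+ (:- (R :* z)) :* w′) :+ (:- (R :* w)) :* z′)
          refl R (f x) (f y) (u x) (v x) (u y) (v y))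
        (p≤q⇒0≤q-p (h x y))))))
    where
    N = ∑ xs (λ _ → 1ℚ)
    S = ∑ xs f
    Q = ∑ xs (λ x → f x * f x)
    U = ∑ xs u
    V = ∑ xs v

  -- Counting indices below a bound

  module _ {P : ℕ → Set} where

    count : (∀ j → Dec (P j)) → ℕ → ℚ
    count P? zero    = 0ℚ
    count P? (suc r) = count P? r + ind (P? r)

    count-all : ∀ P? r → (∀ {j} → j ℕ.< r → P j) → count P? r ≡ ι r
    count-all P? zero    h = refl
    count-all P? (suc r) h = trans
      (cong₂ _+_ (count-all P? r (h ∘ ℕₚ.m<n⇒m<1+n)) (ind-yes (P? r) (h ℕₚ.≤-refl)))
      (trans (+-comm (ι r) 1ℚ) (sym (ι-suc r)))

    count-zero : ∀ P? r → (∀ j → ¬ P j) → count P? r ≡ 0ℚ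
    count-zero P? zero    h = refl
    count-zero P? (suc r) h = trans (cong₂ _+_ (count-zero P? r h) (ind-no (P? r) (h r))) (+-identityʳ 0ℚ)

  -- Extend the range by one index and split off index 0: the extension adds a nonnegative term,
  -- index 0 costs at most 1, and the other indices pass from `P` to `Q`.
  count-shift : ∀ {P Q : ℕ → Set} (P? : ∀ j → Dec (P j)) (Q? : ∀ j → Dec (Q j)) →
    (∀ j → P (suc j) → Q j) → ∀ r → count P? r ≤ 1ℚ + count Q? r
  count-shift {P} {Q} P? Q? h r = ≤-trans
    (subst (_≤ count P? (suc r)) (+-identityʳ (count P? r)) (+-monoʳ-≤ (count P? r) (ind-nonNeg (P? r))))
    (shift r)
    where
    shift : ∀ r → count P? (suc r) ≤ 1ℚ + count Q? r
    shift zero    = subst₂ _≤_ (sym (+-identityˡ (ind (P? 0)))) refl (ind≤1 (P? 0))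
    shift (suc r) = subst (count P? (suc (suc r)) ≤_) (+-assoc 1ℚ (count Q? r) (ind (Q? r)))
      (+-mono-≤ (shift r) (ind-mono (P? (suc r)) (Q? r) (h r)))

  -- Mixed sets

  -- In layer `k + r` this is membership in `∂⁺ r ℱ`; without the size condition it also applies to
  -- the common part of two swapped sets.
  Contains : ∀ {n k} → Family n k → Subset n → Set
  Contains ℱ B = ∃ λ S → Member ℱ S × S ⊆ˢ B

  contains? : ∀ {n k} (ℱ : Family n k) → Decidable (Contains ℱ)
  contains? ℱ B = anySubset? λ S → member? ℱ S ×-dec S ⊆? B

  Contains-mono : ∀ {n k} {ℱ : Family n k} {M B} → M ⊆ˢ B → Contains ℱ M → Contains ℱ B
  Contains-mono M⊆B (S , S∈ , S⊆M) = S , S∈ , ⊆-trans S⊆M M⊆B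

  module _ {n k : ℕ} (𝒜 : Family n k) where

    contains-either : ∀ {B} → k ℕ.≤ size B → Contains 𝒜 B ⊎ Contains (𝒜 ᶜ) B
    contains-either {B} h with subset-of-size k B h
    ... | S , p , S⊆B with member? 𝒜 S
    ...   | yes S∈ = inj₁ (S , S∈ , S⊆B)
    ...   | no  S∉ = inj₂ (S , (p , S∉) , S⊆B)

    -- For `j = 0` a witness exists exactly when `B` contains a member of `𝒜`, since that member has
    -- no other `k`-subset.
    PurePart : Subset n → ℕ → Set
    PurePart B j = ∃ λ M → ¬ Contains (𝒜 ᶜ) M × M ⊆ˢ B × k ℕ.+ j ℕ.≤ size M

    purePart? : ∀ B j → Dec (PurePart B j)
    purePart? B j = anySubset? λ M →
      ¬? (contains? (𝒜 ᶜ) M) ×-dec (M ⊆? B ×-dec (k ℕ.+ j ℕ.≤? size M))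

    -- min(r, s + 1 - k), where s is the largest size of a subset of B all of whose k-subsets lie in 𝒜.
    height : ℕ → Subset n → ℚ
    height r B = count (purePart? B) r

    height-top : ∀ {r B} → size B ≡ k ℕ.+ r → ¬ Contains (𝒜 ᶜ) B → height r B ≡ ι r
    -- A pure set of size `k + r` would reach `r + 1`; only indices below `r` are counted, which
    -- caps the value at `ι r`.
    height-top {r} {B} p pure = count-all (purePart? B) r λ j<r →
      B , pure , ⊆-refl , ℕₚ.≤-trans (ℕₚ.+-monoʳ-≤ k (ℕₚ.<⇒≤ j<r)) (ℕₚ.≤-reflexive (sym p))

    -- A witness has at least `k` elements, hence a `k`-subset, which could lie neither in `𝒜` nor
    -- in `𝒜 ᶜ`.
    height-bottom : ∀ {r B} → ¬ Contains 𝒜 B → height r B ≡ 0ℚ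
    height-bottom {r} {B} empty = count-zero (purePart? B) r none
      where
      none : ∀ j → ¬ PurePart B j
      none j (M , pure , M⊆B , h) with contains-either (ℕₚ.≤-trans (ℕₚ.m≤m+n k j) h)
      ... | inj₁ c = empty (Contains-mono {ℱ = 𝒜} M⊆B c)
      ... | inj₂ c = pure c

    -- Intersecting a witness for `B` with the common part `M` leaves it pure, places it inside `B′`
    -- and removes at most one element, so index `suc j` becomes `j`.
    height-lipschitz : ∀ r {M B B′} → M ⋖ B → M ⋖ B′ → height r B ≤ 1ℚ + height r B′
    height-lipschitz r {M} {B} {B′} M⋖B M⋖B′ = count-shift (purePart? B) (purePart? B′)
      (λ j (T , pure , T⊆B , h) → T ∩ˢ M
        , (λ c → pure (Contains-mono {ℱ = 𝒜 ᶜ} (p∩q⊆p T M) c))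
        , ⊆-trans (p∩q⊆q T M) (⋖⇒⊆ M⋖B′)
        , ℕ.s≤s⁻¹ (begin
            suc (k ℕ.+ j)        ≡⟨ ℕₚ.+-suc k j ⟨
            k ℕ.+ suc j          ≤⟨ h ⟩
            size T               ≡⟨ cong size (⊆⇒∩≡ T⊆B) ⟨
            size (T ∩ˢ B)        ≤⟨ size-∩-⋖ T M⋖B ⟩
            suc (size (T ∩ˢ M))  ∎)) r
      where open ℕₚ.≤-Reasoning

  square-diff≤1 : ∀ {x y} → x ≤ 1ℚ + y → y ≤ 1ℚ + x → (x - y) * (x - y) ≤ 1ℚ
  square-diff≤1 {x} {y} x≤ y≤ = 0≤q-p⇒p≤q (subst (0ℚ ≤_)
    (solve 2 (λ x y → ((con 1ℚ :+ y) :- x) :* ((con 1ℚ :+ x) :- y) := con 1ℚ :- (x :- y) :* (x :- y)) refl x y)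
    (*-nonNeg (p≤q⇒0≤q-p x≤) (p≤q⇒0≤q-p y≤)))

  square-of-equal : ∀ {x y} → x ≡ y → (x - y) * (x - y) ≡ 0ℚ
  square-of-equal {x} refl = solve 1 (λ x → (x :- x) :* (x :- x) := con 0ℚ) refl x

  module Separation {n k : ℕ} (𝒜 : Family n k) (r : ℕ) (0<r : 0 ℕ.< r) where

    private
      K = k ℕ.+ r
      R = ι r * ι r
      f = height 𝒜 r
      ℬ = ∂⁺ r 𝒜 ∩ ∂⁺ r (𝒜 ᶜ)

    χ₁ χ₂ g : Subset n → ℚ
    χ₁ B = ind (contains? 𝒜 B)
    χ₂ B = ind (contains? (𝒜 ᶜ) B)
    g  B = ind (member? ℬ B)

    mixed : ∀ {B} → size B ≡ K → Contains 𝒜 B → Contains (𝒜 ᶜ) B → Member ℬ B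
    mixed p c₁ c₂ = (p , c₁) , (p , c₂)

    -- If one of the sets is mixed, the right side is at least 1 and the Lipschitz bound applies. If
    -- neither is, a `k`-subset of `M` forces both to be of the same kind, where `f` is constant.
    height-gradient : ∀ {M B B′} → suc (size M) ≡ K → M ⋖ B → M ⋖ B′ →
      (f B - f B′) * (f B - f B′) ≤ g B + g B′
    height-gradient {M} {B} {B′} p M⋖B M⋖B′ with member? ℬ B | member? ℬ B′
    ... | yes _ | yes _ = ≤-trans (square-diff≤1 (height-lipschitz 𝒜 r M⋖B M⋖B′) (height-lipschitz 𝒜 r M⋖B′ M⋖B))
                            (+-monoʳ-≤ 1ℚ (<⇒≤ 0<1))
    ... | yes _ | no  _ = square-diff≤1 (height-lipschitz 𝒜 r M⋖B M⋖B′) (height-lipschitz 𝒜 r M⋖B′ M⋖B)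
    ... | no  _ | yes _ = square-diff≤1 (height-lipschitz 𝒜 r M⋖B M⋖B′) (height-lipschitz 𝒜 r M⋖B′ M⋖B)
    ... | no  ¬m | no ¬m′ = ≤-reflexive (square-of-equal (equal (contains-either 𝒜 k≤)))
      where
      size-B : ∀ {B} → M ⋖ B → size B ≡ K
      size-B h = trans (⋖⇒size h) p
      -- The set `M` has `k + r - 1` elements, so `0 < r` is what gives it a `k`-subset.
      k≤ : k ℕ.≤ size M
      k≤ = ℕ.s≤s⁻¹ (subst (suc k ℕ.≤_) (sym p) (ℕₚ.m<m+n k 0<r))
      up : ∀ {ℱ : Family n k} {B} → M ⋖ B → Contains ℱ M → Contains ℱ B
      up {ℱ} M⋖B = Contains-mono {ℱ = ℱ} (⋖⇒⊆ M⋖B)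
      equal : Contains 𝒜 M ⊎ Contains (𝒜 ᶜ) M → f B ≡ f B′
      equal (inj₁ c) = trans
        (height-top 𝒜 (size-B M⋖B) (¬m ∘ mixed (size-B M⋖B) (up {𝒜} M⋖B c)))
        (sym (height-top 𝒜 (size-B M⋖B′) (¬m′ ∘ mixed (size-B M⋖B′) (up {𝒜} M⋖B′ c))))
      equal (inj₂ c) = trans
        (height-bottom 𝒜 {r} (λ c₁ → ¬m (mixed (size-B M⋖B) c₁ (up {𝒜 ᶜ} M⋖B c))))
        (sym (height-bottom 𝒜 {r} (λ c₁ → ¬m′ (mixed (size-B M⋖B′) c₁ (up {𝒜 ᶜ} M⋖B′ c)))))

    size≥k : ∀ (B : Subset n) → size B ≡ K → k ℕ.≤ size B
    size≥k B p = subst (k ℕ.≤_) (sym p) (ℕₚ.m≤m+n k r)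

    -- On mixed sets `f` is left unspecified, because `1ℚ - χ₁` and `1ℚ - χ₂` vanish there.
    data Kind (B : Subset n) : Set where
      top    : f B ≡ ι r → χ₁ B ≡ 1ℚ → χ₂ B ≡ 0ℚ → g B ≡ 0ℚ → Kind B
      bottom : f B ≡ 0ℚ → χ₁ B ≡ 0ℚ → χ₂ B ≡ 1ℚ → g B ≡ 0ℚ → Kind B
      both   : χ₁ B ≡ 1ℚ → χ₂ B ≡ 1ℚ → g B ≡ 1ℚ → Kind B

    kind : ∀ B → size B ≡ K → Kind B
    kind B p with contains? 𝒜 B in eq₁ | contains? (𝒜 ᶜ) B in eq₂
    ... | yes c₁ | yes c₂ = both (cong ind eq₁) (cong ind eq₂) (ind-yes (member? ℬ B) (mixed p c₁ c₂))
    ... | yes c₁ | no ¬c₂ = top (height-top 𝒜 p ¬c₂) (cong ind eq₁) (cong ind eq₂)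
                              (ind-no (member? ℬ B) (¬c₂ ∘ proj₂ ∘ proj₂))
    ... | no ¬c₁ | yes c₂ = bottom (height-bottom 𝒜 {r} ¬c₁) (cong ind eq₁) (cong ind eq₂)
                              (ind-no (member? ℬ B) (¬c₁ ∘ proj₂ ∘ proj₁))
    ... | no ¬c₁ | no ¬c₂ with contains-either 𝒜 (size≥k B p)
    ...   | inj₁ c₁ = contradiction c₁ ¬c₁
    ...   | inj₂ c₂ = contradiction c₂ ¬c₂

    inclusion-exclusion : ∀ B → size B ≡ K → χ₁ B + χ₂ B ≡ 1ℚ + g B
    inclusion-exclusion B p with kind B p
    ... | top    _ h₁ h₂ h rewrite h₁ | h₂ | h = refl
    ... | bottom _ h₁ h₂ h rewrite h₁ | h₂ | h = refl
    ... | both     h₁ h₂ h rewrite h₁ | h₂ | h = refl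

    -- The left side is nonzero only for two unmixed sets of opposite kinds, where `f` takes the
    -- values `ι r` and 0. Its symmetric form is the one that `variance-lower` sums.
    height-separates : ∀ B B′ → size B ≡ K → size B′ ≡ K →
      R * ((1ℚ - χ₂ B) * (1ℚ - χ₁ B′) + (1ℚ - χ₁ B) * (1ℚ - χ₂ B′)) ≤ (f B′ - f B) * (f B′ - f B)
    height-separates B B′ p p′ with kind B p | kind B′ p′
    ... | both h₁ h₂ _ | _ rewrite h₁ | h₂ = ≤-trans
      (≤-reflexive (solve 3 (λ R a b → R :* (con 0ℚ :* a :+ con 0ℚ :* b) := con 0ℚ) refl R (1ℚ - χ₁ B′) (1ℚ - χ₂ B′)))
      (square-nonNeg (f B′ - f B))
    ... | _ | both h₁ h₂ _ rewrite h₁ | h₂ = ≤-trans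
      (≤-reflexive (solve 3 (λ R a b → R :* (a :* con 0ℚ :+ b :* con 0ℚ) := con 0ℚ) refl R (1ℚ - χ₂ B) (1ℚ - χ₁ B)))
      (square-nonNeg (f B′ - f B))
    ... | top e h₁ h₂ _ | top e′ h₁′ h₂′ _ rewrite e | e′ | h₁ | h₂ | h₁′ | h₂′ =
      ≤-reflexive (solve 1 (λ r → (r :* r) :* con 0ℚ := (r :- r) :* (r :- r)) refl (ι r))
    ... | bottom e h₁ h₂ _ | bottom e′ h₁′ h₂′ _ rewrite e | e′ | h₁ | h₂ | h₁′ | h₂′ =
      ≤-reflexive (solve 1 (λ r → (r :* r) :* con 0ℚ := con 0ℚ) refl (ι r))
    ... | top e h₁ h₂ _ | bottom e′ h₁′ h₂′ _ rewrite e | e′ | h₁ | h₂ | h₁′ | h₂′ =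
      ≤-reflexive (solve 1 (λ r → (r :* r) :* con 1ℚ := (con 0ℚ :- r) :* (con 0ℚ :- r)) refl (ι r))
    ... | bottom e h₁ h₂ _ | top e′ h₁′ h₂′ _ rewrite e | e′ | h₁ | h₂ | h₁′ | h₂′ =
      ≤-reflexive (solve 1 (λ r → (r :* r) :* con 1ℚ := (r :- con 0ℚ) :* (r :- con 0ℚ)) refl (ι r))

    -- The unmixed sets of the two kinds number `N - W` and `N - U`, and variance bounds control
    -- their product. By inclusion-exclusion `U * W` is larger by `N * G`, whence the extra `R`.
    shadows-product : R * (∑ₗ n K χ₁ * ∑ₗ n K χ₂) ≤ (ι n + R) * (#ₗ n K * ∑ₗ n K g)
    shadows-product = begin
      R * (U * W)
        ≡⟨ solve 4 (λ R N U W → R :* (U :* W)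
             := R :* ((N :- W) :* (N :- U)) :+ R :* (N :* ((U :+ W) :- N))) refl R N U W ⟩
      R * ((N - W) * (N - U)) + R * (N * ((U + W) - N))
        ≡⟨ cong (λ t → R * ((N - W) * (N - U)) + R * (N * (t - N))) U+W ⟩
      R * ((N - W) * (N - U)) + R * (N * ((N + G) - N))
        ≡⟨ cong (R * ((N - W) * (N - U)) +_)
             (solve 3 (λ R N G → R :* (N :* ((N :+ G) :- N)) := R :* (N :* G)) refl R N G) ⟩
      R * ((N - W) * (N - U)) + R * (N * G)
        ≡⟨ cong₂ (λ s t → R * (s * t) + R * (N * G))
             (sym (∑-- (layers n K) (λ _ → 1ℚ) (χ₂ ∘ proj₁)))
             (sym (∑-- (layers n K) (λ _ → 1ℚ) (χ₁ ∘ proj₁))) ⟩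
      R * (∑ₗ n K (λ B → 1ℚ - χ₂ B) * ∑ₗ n K (λ B → 1ℚ - χ₁ B)) + R * (N * G)
        ≤⟨ +-monoˡ-≤ (R * (N * G)) (≤-trans
             (variance-lower (layers n K) R (f ∘ proj₁) (λ (B , _) → 1ℚ - χ₂ B) (λ (B , _) → 1ℚ - χ₁ B)
               (λ (B , p) (B′ , p′) → height-separates B B′ p p′))
             (poincaré n K f g (λ B → ind-nonNeg (member? ℬ B)) height-gradient)) ⟩
      ι n * (N * G) + R * (N * G)
        ≡⟨ *-distribʳ-+ (N * G) (ι n) R ⟨
      (ι n + R) * (N * G) ∎
      where
      open ≤-Reasoning
      N = #ₗ n K
      U = ∑ₗ n K χ₁
      W = ∑ₗ n K χ₂
      G = ∑ₗ n K g
      U+W : U + W ≡ N + G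
      U+W = trans (sym (∑-+ (layers n K) (χ₁ ∘ proj₁) (χ₂ ∘ proj₁)))
        (trans (∑-cong (layers n K) λ (B , p) → inclusion-exclusion B p)
          (∑-+ (layers n K) (λ _ → 1ℚ) (g ∘ proj₁)))

    -- The indicator of `Contains ℱ` is monotone along covering pairs, so normalized matching
    -- carries a density bound up to layer `K`.
    shadow-density : ∀ q (ℱ : Family n k) → K ℕ.≤ n →
      q * #ₗ n k ≤ ∑ₗ n k (ind ∘ contains? ℱ) → q * #ₗ n K ≤ ∑ₗ n K (ind ∘ contains? ℱ)
    shadow-density q ℱ K≤n h = cancel-≤ N (#ₗ-pos (ℕₚ.≤-trans (ℕₚ.m≤m+n k r) K≤n)) (begin
      (q * N′) * N  ≡⟨ solve 3 (λ a b c → (a :* b) :* c := (a :* c) :* b) refl q N′ N ⟩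
      (q * N) * N′  ≤⟨ *ʳ-mono N′ (#ₗ-nonNeg n K) h ⟩
      ∑ₗ n k (ind ∘ contains? ℱ) * N′
                    ≤⟨ normalized-matching (ind ∘ contains? ℱ) r K≤n (λ {M} {B} M⋖B →
                         ind-mono (contains? ℱ M) (contains? ℱ B) (Contains-mono {ℱ = ℱ} (⋖⇒⊆ M⋖B))) ⟩
      ∑ₗ n K (ind ∘ contains? ℱ) * N ∎)
      where
      open ≤-Reasoning
      N = #ₗ n k
      N′ = #ₗ n K

    -- The shadows have densities at least `q` and `1ℚ - q`; these enter `shadows-product`, and the
    -- square of the layer size cancels.
    mixed-density : K ℕ.≤ n → let q = ratio (card 𝒜) (n C k) in
      R * (q * (1ℚ - q)) ≤ (ι n + R) * ratio (card ℬ) (n C K)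
    mixed-density K≤n = cancel-≤ (N′ * N′) (*-pos 0<N′ 0<N′) (begin
      (R * (q * (1ℚ - q))) * (N′ * N′)
        ≡⟨ solve 4 (λ R q p N → (R :* (q :* p)) :* (N :* N) := R :* ((q :* N) :* (p :* N))) refl R q (1ℚ - q) N′ ⟩
      R * ((q * N′) * ((1ℚ - q) * N′))
        ≤⟨ *ˡ-mono R (square-nonNeg (ι r)) (*-mono-≤ (*-nonNeg 0≤q (<⇒≤ 0<N′)) hU (*-nonNeg 0≤1-q (<⇒≤ 0<N′)) hW) ⟩
      R * (∑ₗ n K χ₁ * ∑ₗ n K χ₂)
        ≤⟨ shadows-product ⟩
      (ι n + R) * (N′ * ∑ₗ n K g)
        ≡⟨ cong (λ t → (ι n + R) * (N′ * t)) (trans (sym (ι-card ℬ)) (sym z-cancel)) ⟩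
      (ι n + R) * (N′ * (z * N′))
        ≡⟨ solve 3 (λ c N z → c :* (N :* (z :* N)) := (c :* z) :* (N :* N)) refl (ι n + R) N′ z ⟩
      ((ι n + R) * z) * (N′ * N′) ∎)
      where
      open ≤-Reasoning
      N = #ₗ n k
      N′ = #ₗ n K
      q = ratio (card 𝒜) (n C k)
      z = ratio (card ℬ) (n C K)
      A = ∑ₗ n k (ind ∘ member? 𝒜)
      0<N : 0ℚ < N
      0<N = #ₗ-pos (ℕₚ.≤-trans (ℕₚ.m≤m+n k r) K≤n)
      0<N′ : 0ℚ < N′
      0<N′ = #ₗ-pos K≤n
      z-cancel : z * N′ ≡ ι (card ℬ)
      z-cancel = trans (cong (z *_) (sym (ι-C n K))) (ratio-cancel (card ℬ) (n C K) (subst (0ℚ <_) (sym (ι-C n K)) 0<N′))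
      q-cancel : q * N ≡ A
      q-cancel = trans (cong (q *_) (sym (ι-C n k)))
        (trans (ratio-cancel (card 𝒜) (n C k) (subst (0ℚ <_) (sym (ι-C n k)) 0<N)) (ι-card 𝒜))
      1-q-cancel : (1ℚ - q) * N ≡ ∑ₗ n k (λ S → 1ℚ - ind (member? 𝒜 S))
      1-q-cancel = trans (solve 2 (λ q N → (con 1ℚ :- q) :* N := N :- q :* N) refl q N)
        (trans (cong (λ t → N - t) q-cancel) (sym (∑-- (layers n k) (λ _ → 1ℚ) (λ (S , _) → ind (member? 𝒜 S)))))
      0≤q : 0ℚ ≤ q
      0≤q = cancel-≤ N 0<N (subst₂ _≤_ (sym (*-zeroˡ N)) (sym q-cancel)
        (∑ₗ-nonNeg n k λ S → ind-nonNeg (member? 𝒜 S)))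
      0≤1-q : 0ℚ ≤ 1ℚ - q
      0≤1-q = cancel-≤ N 0<N (subst₂ _≤_ (sym (*-zeroˡ N)) (sym 1-q-cancel)
        (∑ₗ-nonNeg n k λ S → p≤q⇒0≤q-p (ind≤1 (member? 𝒜 S))))
      hU : q * N′ ≤ ∑ₗ n K χ₁
      hU = shadow-density q 𝒜 K≤n (subst (_≤ ∑ₗ n k χ₁) (sym q-cancel)
        (∑-mono (layers n k) λ (S , _) → ind-mono (member? 𝒜 S) (contains? 𝒜 S) λ S∈ → S , S∈ , ⊆-refl))
      hW : (1ℚ - q) * N′ ≤ ∑ₗ n K χ₂
      hW = shadow-density (1ℚ - q) (𝒜 ᶜ) K≤n (subst (_≤ ∑ₗ n k χ₂) (sym 1-q-cancel) (∑-mono (layers n k) λ (S , p) → complement S p))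
        where
        complement : ∀ S → size S ≡ k → 1ℚ - ind (member? 𝒜 S) ≤ ind (contains? (𝒜 ᶜ) S)
        complement S p with member? 𝒜 S
        ... | yes _  = ind-nonNeg (contains? (𝒜 ᶜ) S)
        ... | no  S∉ = ≤-reflexive (sym (ind-yes (contains? (𝒜 ᶜ) S) (S , (p , S∉) , ⊆-refl)))

  -- Rational approximants

  ¾ : ℚ
  ¾ = ℤ.+ 3 / 4

  leftSum-nonNeg : ∀ {b} k → 1ℚ ≤ b → 0ℚ ≤ leftSum k 1ℚ b
  leftSum-nonNeg k 1≤b = ≤-trans
    (*-nonNeg (p≤q⇒0≤q-p 1≤b) (<⇒≤ (⁻¹-pos (<-≤-trans 0<1 1≤b))))
    (leftSum-lower 0<1 1≤b ≤-refl k)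

  -- The integrand is at least `b ⁻¹` on the interval, so each Riemann sum is at least `1ℚ - b ⁻¹`.
  leftSum≥¾ : ∀ {b} k → ι 4 ≤ b → ¾ ≤ leftSum k 1ℚ b
  leftSum≥¾ {b} k 4≤b = begin
    1ℚ - ι 4 ⁻¹       ≤⟨ +-monoʳ-≤ 1ℚ (neg-antimono-≤ (⁻¹-anti (ι-pos {4} (s≤s z≤n)) 4≤b)) ⟩
    1ℚ - b ⁻¹         ≡⟨ cong (_- b ⁻¹) (⁻¹-inverseʳ (<-≤-trans 0<1 1≤b)) ⟨
    b * b ⁻¹ - b ⁻¹   ≡⟨ solve 2 (λ b i → b :* i :- i := (b :- con 1ℚ) :* i) refl b (b ⁻¹) ⟩
    (b - 1ℚ) * b ⁻¹   ≤⟨ leftSum-lower 0<1 1≤b ≤-refl k ⟩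
    leftSum k 1ℚ b    ∎
    where
    open ≤-Reasoning
    1≤b : 1ℚ ≤ b
    1≤b = ≤-trans (ι-mono {1} {4} (s≤s z≤n)) 4≤b

  q[1-q]≤¼ : ∀ q → q * (1ℚ - q) ≤ ½ * ½
  q[1-q]≤¼ q = 0≤q-p⇒p≤q (subst (0ℚ ≤_)
    (solve 1 (λ q → (q :- con ½) :* (q :- con ½) := con ½ :* con ½ :- q :* (con 1ℚ :- q)) refl q)
    (square-nonNeg (q - ½)))

  4≤⁻¹ : ∀ {t} → 0ℚ < t → t ≤ ½ * ½ → ι 4 ≤ t ⁻¹
  -- The reciprocal of `½ * ½` computes to `ι 4`.
  4≤⁻¹ 0<t t≤¼ = ⁻¹-anti 0<t t≤¼

  1≤⁻¹ : ∀ {t} → 0ℚ < t → t ≤ 1ℚ → 1ℚ ≤ t ⁻¹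
  1≤⁻¹ 0<t t≤1 = ⁻¹-anti 0<t t≤1

  square≤1 : ∀ {e} → 0ℚ ≤ e → e ≤ 1ℚ → e * e ≤ 1ℚ
  square≤1 0≤e e≤1 = *-mono-≤ 0≤e e≤1 0≤e e≤1

  module _ (n i : ℕ) (1≤n : 1 ℕ.≤ n) where

    private
      K = suc i
      a = isqrt (n ℕ.* (K ℕ.* K))
      s = sqrtApprox n i
      0<ιK : 0ℚ < ι K
      0<ιK = ι-pos {K} (s≤s z≤n)
      sK : s * ι K ≡ ι a
      sK = ratio-cancel a K 0<ιK

      K≤a : K ℕ.≤ a
      K≤a = ℕₚ.≮⇒≥ λ a<K → ℕₚ.<⇒≱ (isqrt-upper (n ℕ.* (K ℕ.* K))) (ℕₚ.≤-trans
        (ℕₚ.*-mono-≤ a<K a<K)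
        (ℕₚ.≤-trans (ℕₚ.≤-reflexive (sym (ℕₚ.*-identityˡ (K ℕ.* K)))) (ℕₚ.*-monoˡ-≤ (K ℕ.* K) 1≤n)))

      ι-nKK : ι (n ℕ.* (K ℕ.* K)) ≡ ι n * (ι K * ι K)
      ι-nKK = trans (ι-* n (K ℕ.* K)) (cong (ι n *_) (ι-* K K))

      ss : ∀ c → (c * (s * s)) * (ι K * ι K) ≡ c * (ι a * ι a)
      ss c = trans (solve 3 (λ c s k → (c :* (s :* s)) :* (k :* k) := c :* ((s :* k) :* (s :* k))) refl c s (ι K))
        (cong₂ (λ t u → c * (t * u)) sK sK)

    1≤sqrtApprox : 1ℚ ≤ s
    1≤sqrtApprox = cancel-≤ (ι K) 0<ιK (subst₂ _≤_ (sym (*-identityˡ (ι K))) (sym sK) (ι-mono K≤a))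

    sqrtApprox²≤ : s * s ≤ ι n
    sqrtApprox²≤ = cancel-≤ (ι K * ι K) (*-pos 0<ιK 0<ιK) (begin
      (s * s) * (ι K * ι K)          ≡⟨ cong (_* (ι K * ι K)) (*-identityˡ (s * s)) ⟨
      (1ℚ * (s * s)) * (ι K * ι K)   ≡⟨ ss 1ℚ ⟩
      1ℚ * (ι a * ι a)               ≡⟨ *-identityˡ (ι a * ι a) ⟩
      ι a * ι a                      ≡⟨ ι-* a a ⟨
      ι (a ℕ.* a)                    ≤⟨ ι-mono (isqrt-lower (n ℕ.* (K ℕ.* K))) ⟩
      ι (n ℕ.* (K ℕ.* K))            ≡⟨ ι-nKK ⟩
      ι n * (ι K * ι K)              ∎)
      where open ≤-Reasoning

    -- Rounding down loses at most a factor 2 in the root: `K ≤ a` gives `1 ≤ a`, hence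
    -- `suc a ≤ a + a`.
    ≤4sqrtApprox² : ι n ≤ ι 4 * (s * s)
    ≤4sqrtApprox² = cancel-≤ (ι K * ι K) (*-pos 0<ιK 0<ιK) (begin
      ι n * (ι K * ι K)              ≡⟨ ι-nKK ⟨
      ι (n ℕ.* (K ℕ.* K))            ≤⟨ ι-mono (ℕₚ.<⇒≤ (isqrt-upper (n ℕ.* (K ℕ.* K)))) ⟩
      ι (suc a ℕ.* suc a)            ≡⟨ ι-* (suc a) (suc a) ⟩
      ι (suc a) * ι (suc a)          ≤⟨ *-mono-≤ (ι-nonNeg (suc a)) 1+a≤ (ι-nonNeg (suc a)) 1+a≤ ⟩
      (ι a + ι a) * (ι a + ι a)      ≡⟨ solve 1 (λ a → (a :+ a) :* (a :+ a) := con (ι 4) :* (a :* a)) refl (ι a) ⟩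
      ι 4 * (ι a * ι a)              ≡⟨ ss (ι 4) ⟨
      (ι 4 * (s * s)) * (ι K * ι K)  ∎)
      where
      open ≤-Reasoning
      1+a≤ : ι (suc a) ≤ ι a + ι a
      1+a≤ = subst (ι (suc a) ≤_) (ι-+ a a) (ι-mono (ℕₚ.+-monoˡ-≤ a (ℕₚ.≤-trans (s≤s z≤n) K≤a)))

  -- The factor 4 is chosen so that its product with the lower bound `¾` for the second logarithm is
  -- 3.
  threshold≥3 : ∀ {e L L′} → 0ℚ < e → e ≤ 1ℚ → 0ℚ ≤ L → ¾ ≤ L′ →
    ι 3 ≤ (ι 4 * (e * e) ⁻¹) * (L + L′)
  threshold≥3 {e} {L} {L′} 0<e e≤1 0≤L ¾≤L′ = *-mono-≤ {ι 4} {ι 4 * (e * e) ⁻¹} {¾} {L + L′}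
    (ι-nonNeg 4)
    (*ˡ-mono (ι 4) (ι-nonNeg 4) (1≤⁻¹ (*-pos 0<e 0<e) (square≤1 (<⇒≤ 0<e) e≤1)))
    (nonNegative⁻¹ ¾)
    (≤-trans (≤-reflexive (sym (+-identityˡ ¾))) (+-mono-≤ 0≤L ¾≤L′))

  module _ {n r e s m z} (1≤r : 1ℚ ≤ r) (0≤n : 0ℚ ≤ n) (0≤e : 0ℚ ≤ e) (e≤1 : e ≤ 1ℚ) (0≤s : 0ℚ ≤ s)
    (es≤ : e * s ≤ r + 1ℚ) (n≤ : n ≤ ι 4 * (s * s)) (0≤m : 0ℚ ≤ m)
    (h : (r * r) * m ≤ (n + r * r) * z) where

    private
      R = r * r
      0<R : 0ℚ < R
      0<R = *-pos (<-≤-trans 0<1 1≤r) (<-≤-trans 0<1 1≤r)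

      0≤z : 0ℚ ≤ z
      0≤z = cancel-≤ (n + R) (subst (_< n + R) (+-identityˡ 0ℚ) (+-mono-≤-< 0≤n 0<R))
        (subst₂ _≤_ (sym (*-zeroˡ (n + R))) (*-comm (n + R) z) (≤-trans (*-nonNeg (<⇒≤ 0<R) 0≤m) h))

      een≤ : (e * e) * n ≤ ι 16 * R
      een≤ = begin
        (e * e) * n                ≤⟨ *ˡ-mono (e * e) (square-nonNeg e) n≤ ⟩
        (e * e) * (ι 4 * (s * s))  ≡⟨ solve 2 (λ e s → (e :* e) :* (con (ι 4) :* (s :* s))
                                        := con (ι 4) :* ((e :* s) :* (e :* s))) refl e s ⟩
        ι 4 * ((e * s) * (e * s))  ≤⟨ *ˡ-mono (ι 4) (ι-nonNeg 4)
                                        (*-mono-≤ (*-nonNeg 0≤e 0≤s) es≤2r (*-nonNeg 0≤e 0≤s) es≤2r) ⟩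
        ι 4 * ((r + r) * (r + r))  ≡⟨ solve 1 (λ r → con (ι 4) :* ((r :+ r) :* (r :+ r)) := con (ι 16) :* (r :* r)) refl r ⟩
        ι 16 * R                   ∎
        where
        open ≤-Reasoning
        es≤2r : e * s ≤ r + r
        -- The error 1 in `es≤`, left by passing to approximants, is absorbed by `1ℚ ≤ r`.
        es≤2r = ≤-trans es≤ (+-monoʳ-≤ r 1≤r)

    -- Multiply `h` by `e * e`: of the factor 17, 16 comes from `een≤` and 1 from `e * e ≤ 1ℚ`.
    eem≤17z : (e * e) * m ≤ ι 17 * z
    eem≤17z = cancel-≤ R 0<R (begin
      ((e * e) * m) * R                ≡⟨ solve 3 (λ w m R → (w :* m) :* R := w :* (R :* m)) refl (e * e) m R ⟩
      (e * e) * (R * m)                ≤⟨ *ˡ-mono (e * e) (square-nonNeg e) h ⟩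
      (e * e) * ((n + R) * z)          ≡⟨ solve 4 (λ w n R z → w :* ((n :+ R) :* z) := (w :* n :+ w :* R) :* z)
                                            refl (e * e) n R z ⟩
      ((e * e) * n + (e * e) * R) * z  ≤⟨ *ʳ-mono z 0≤z (+-mono-≤ een≤ (*ʳ-mono R (<⇒≤ 0<R) (square≤1 0≤e e≤1))) ⟩
      (ι 16 * R + 1ℚ * R) * z          ≡⟨ solve 2 (λ R z → (con (ι 16) :* R :+ con 1ℚ :* R) :* z
                                            := (con (ι 17) :* z) :* R) refl R z ⟩
      (ι 17 * z) * R                   ∎)
      where open ≤-Reasoning

    -- The constant is 3/68 = (3/4) / 17, to offset L ⁻¹ ≤ 4/3 and the factor 17 of eem≤17z.
    bound≤z : ∀ {L} → ¾ ≤ L → ((ℤ.+ 3 / 68) * ((e * e) * L ⁻¹)) * m ≤ z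
    bound≤z {L} ¾≤L = begin
      (c * ((e * e) * L ⁻¹)) * m     ≡⟨ solve 3 (λ w l m → (con c :* (w :* l)) :* m := con c :* ((w :* m) :* l)) refl (e * e) (L ⁻¹) m ⟩
      c * (((e * e) * m) * L ⁻¹)     ≤⟨ *ˡ-mono c (nonNegative⁻¹ c)
                                          (*-mono-≤ (*-nonNeg (square-nonNeg e) 0≤m) eem≤17z
                                            (<⇒≤ (⁻¹-pos (<-≤-trans 0<¾ ¾≤L))) (⁻¹-anti 0<¾ ¾≤L)) ⟩
      c * ((ι 17 * z) * ¾ ⁻¹)        ≡⟨ solve 1 (λ z → con c :* ((con (ι 17) :* z) :* con (¾ ⁻¹)) := z) refl z ⟩
      z ∎
      where
      open ≤-Reasoning
      c = ℤ.+ 3 / 68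
      0<¾ : 0ℚ < ¾
      0<¾ = positive⁻¹ ¾

  -- The radius is `suc r` here, and its layer must be nonempty. If `k ≤ r`, then `k * k < k * 2`,
  -- so `k ≤ 1` and `n ≤ 2`.
  small-radius : ∀ {k r n} → k ℕ.* 2 ≡ n → 3 ℕ.≤ n → r ℕ.* r ℕ.< n → k ℕ.+ suc r ℕ.≤ n
  small-radius {k} {r} refl 3≤n r²<n = subst (k ℕ.+ suc r ℕ.≤_) 2k (ℕₚ.+-monoʳ-≤ k r<k)
    where
    2k : k ℕ.+ k ≡ k ℕ.* 2
    2k = trans (cong (k ℕ.+_) (sym (ℕₚ.+-identityʳ k))) (ℕₚ.*-comm 2 k)
    r<k : r ℕ.< k
    r<k = ℕₚ.≰⇒> λ k≤r → ℕₚ.<⇒≱ 3≤n (ℕₚ.*-monoˡ-≤ 2 (ℕ.s≤s⁻¹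
      (ℕₚ.*-cancelˡ-< k k 2 (ℕₚ.≤-<-trans (ℕₚ.*-mono-≤ k≤r k≤r) r²<n))))

  -- The ceiling condition puts `suc r` less one strictly below ε√n, hence below √n; the gap `g`
  -- keeps this strict for the approximants.
  radius-bound : ∀ {r e s n g} → 0ℚ < g → e ≤ 1ℚ → 0ℚ ≤ s → s * s ≤ ι n →
    (ι (suc r) - 1ℚ) + g ≤ e * s → r ℕ.* r ℕ.< n
  radius-bound {r} {e} {s} {n} {g} 0<g e≤1 0≤s s²≤n h = ι-cancel-< (begin-strict
    ι (r ℕ.* r)  ≡⟨ ι-* r r ⟩
    ι r * ι r    ≤⟨ *ˡ-mono (ι r) (ι-nonNeg r) (<⇒≤ r<s) ⟩
    ι r * s      <⟨ *-monoˡ-<-pos s {{positive (≤-<-trans (ι-nonNeg r) r<s)}} r<s ⟩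
    s * s        ≤⟨ s²≤n ⟩
    ι n          ∎)
    where
    open ≤-Reasoning
    r<s : ι r < s
    r<s = begin-strict
      ι r                     ≡⟨ +-identityʳ (ι r) ⟨
      ι r + 0ℚ                <⟨ +-monoʳ-< (ι r) 0<g ⟩
      ι r + g                 ≡⟨ cong (_+ g) (solve 1 (λ r → r := (con 1ℚ :+ r) :- con 1ℚ) refl (ι r)) ⟩
      ((1ℚ + ι r) - 1ℚ) + g   ≡⟨ cong (λ t → (t - 1ℚ) + g) (ι-suc r) ⟨
      (ι (suc r) - 1ℚ) + g    ≤⟨ h ⟩
      e * s                   ≤⟨ *ʳ-mono s 0≤s e≤1 ⟩
      1ℚ * s                  ≡⟨ *-identityˡ s ⟩
      s                       ∎

open import Defs
open import Data.Nat using (ℕ; NonZero; _/_)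
open import Data.Nat.Divisibility using (_∣_)
open import Data.Integer using (+_)
open import Data.Product using (Σ-syntax; _×_)
open import Data.Nat using (zero; suc; _⊔_)
import Data.Nat as ℕ
import Data.Nat.Properties as ℕₚ
open import Data.Nat.DivMod using (m/n*n≡m)
open import Data.Nat.Combinatorics using (_C_)
open import Data.Product using (∃; _,_; proj₁; proj₂)
open import Data.Rational using (ℚ; 0ℚ; 1ℚ; ½)
import Data.Rational as ℚ
import Data.Rational.Properties as ℚₚ
open import Data.Rational.Solver
open import Relation.Nullary using (yes; no; contradiction)
open import Relation.Binary.PropositionalEquality
open Slice
open Auxiliary using (*-pos; *-mono-≤; ≤abs; 0<½; p-q≤r⇒p≤r+q)

-- From real inequalities to approximants

fromℚ-positive : ∀ {p} → 0ℚ ℚ.< p → 0ℝ < fromℚ p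
fromℚ-positive {p} 0<p = record
  { gap = p ; gap>0 = 0<p ; from = 0 ; separated = λ _ _ → ℚₚ.≤-reflexive (ℚₚ.+-identityˡ p) }

-- Past `N` the sequence varies by at most 1/4, so comparing its `N`-th term with `p + ¾` decides:
-- either later terms stay below `p + 1`, or they exceed `p` by the gap `½`, which `x≤p` forbids.
≤-eventually : ∀ {x p} → x ≤ fromℚ p → ∃ λ N → ∀ i → N ℕ.≤ i → seq x i ℚ.≤ p ℚ.+ 1ℚ
≤-eventually {x} {p} x≤p with cauchy x (½ ℚ.* ½) (*-pos 0<½ 0<½)
... | N , close with seq x N ℚ.≤? p ℚ.+ ¾
...   | yes h = N , λ i N≤i → ℚₚ.≤-trans
  (p-q≤r⇒p≤r+q (ℚₚ.≤-trans (≤abs _) (close i N N≤i ℕₚ.≤-refl)))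
  (ℚₚ.≤-trans (ℚₚ.+-monoʳ-≤ (½ ℚ.* ½) h)
    (ℚₚ.≤-reflexive (solve 1 (λ p → con (½ ℚ.* ½) :+ (p :+ con ¾) := p :+ con 1ℚ) refl p)))
  where open +-*-Solver
...   | no ¬h = contradiction
  (record
    { gap = ½ ; gap>0 = 0<½ ; from = N
    ; separated = λ i N≤i → +-cancelʳ-≤ (½ ℚ.* ½) (ℚₚ.≤-trans
        (ℚₚ.≤-reflexive (solve 1 (λ p → (p :+ con ½) :+ con (½ ℚ.* ½) := p :+ con ¾) refl p))
        (ℚₚ.≤-trans (ℚₚ.<⇒≤ (ℚₚ.≰⇒> ¬h))
          (subst (seq x N ℚ.≤_) (ℚₚ.+-comm (½ ℚ.* ½) (seq x i))
            (p-q≤r⇒p≤r+q (ℚₚ.≤-trans (≤abs _) (close N i ℕₚ.≤-refl N≤i)))))) })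
  x≤p
  where open +-*-Solver

module _ (ε : ℝ) {{0<ε : 0ℝ < ε}} {{ε<1 : ε < 1ℝ}} (n : ℕ) .{{_ : NonZero n}} (2∣n : 2 ∣ n)
  (𝒜 : Family n (n / 2)) {{_ : Proper 𝒜}} where

  private
    open ℕₚ using (m⊔n≤o⇒m≤o; m⊔n≤o⇒n≤o)
    module P = _<_ 0<ε
    module U = _<_ ε<1
    e = seq ε
    q = ratio (card 𝒜) (n C (n / 2))
    m = q ℚ.* (1ℚ ℚ.- q)

    1≤n : 1 ℕ.≤ n
    1≤n = ℕₚ.n≢0⇒n>0 (ℕ.≢-nonZero⁻¹ n)

    0<m : 0ℚ ℚ.< m
    0<m = ℚₚ.<-≤-trans (_<_.gap>0 0<μ[1-μ]) (proj₂ (positive⇒above 0<μ[1-μ]) _ ℕₚ.≤-refl)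
      where
      0<μ[1-μ] : 0ℝ < μ 𝒜 * (1ℝ - μ 𝒜)
      0<μ[1-μ] = *-positive

    e-gap : ∀ i → P.from ℕ.≤ i → P.gap ℚ.≤ e i
    e-gap = proj₂ (positive⇒above 0<ε)

    0<e : ∀ i → P.from ℕ.≤ i → 0ℚ ℚ.< e i
    0<e i h = ℚₚ.<-≤-trans P.gap>0 (e-gap i h)

    e≤1 : ∀ i → U.from ℕ.≤ i → e i ℚ.≤ 1ℚ
    e≤1 i h = ℚₚ.≤-trans
      (subst (ℚ._≤ e i ℚ.+ U.gap) (ℚₚ.+-identityʳ (e i)) (ℚₚ.+-monoʳ-≤ (e i) (ℚₚ.<⇒≤ U.gap>0)))
      (U.separated i h)

    0≤s : ∀ i → 0ℚ ℚ.≤ sqrtApprox n i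
    0≤s i = ℚₚ.≤-trans (ℚₚ.<⇒≤ Auxiliary.0<1) (1≤sqrtApprox n i 1≤n)

  -- The two real expressions of the statement enter through their rational approximations.
  threshold⇒3≤n : ∀ {x} → x ≤ fromℕ n →
    (∀ i → seq x i ≡ (ι 4 ℚ.* (e i ℚ.* e i) ⁻¹) ℚ.* (leftSum i 1ℚ (e i ⁻¹) ℚ.+ leftSum i 1ℚ (m ⁻¹))) →
    3 ℕ.≤ n
  -- If `n` were at most 2, the approximants of `x`, eventually at least 3, would exceed it by the
  -- gap 1.
  threshold⇒3≤n x≤n seq-x = ℕₚ.≮⇒≥ λ n<3 → x≤n (record
    { gap = 1ℚ ; gap>0 = Auxiliary.0<1 ; from = P.from ⊔ U.from
    ; separated = λ i h →
        let 0<ei = 0<e i (m⊔n≤o⇒m≤o P.from U.from h)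
            ei≤1 = e≤1 i (m⊔n≤o⇒n≤o P.from U.from h)
        in ℚₚ.≤-trans
          (ℚₚ.+-monoˡ-≤ 1ℚ (ι-mono (ℕ.s≤s⁻¹ n<3)))
          (subst (ι 3 ℚ.≤_) (sym (seq-x i))
            (threshold≥3 0<ei ei≤1 (leftSum-nonNeg i (1≤⁻¹ 0<ei ei≤1))
              (leftSum≥¾ i (4≤⁻¹ 0<m (q[1-q]≤¼ q))))) })

  mixed-measure-bound : 3 ℕ.≤ n → ∀ r → ε * √ n ≤ fromℤ (+ r) → fromℤ (+ r) - 1ℝ < ε * √ n →
    ∀ {y} → (∀ i → seq y i ≡
      ((+ 3 ℚ./ 68) ℚ.* ((e i ℚ.* e i) ℚ.* leftSum i 1ℚ ((e i ℚ.* m) ⁻¹) ⁻¹)) ℚ.* m) →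
    y ≤ μ (∂⁺ r 𝒜 ∩ ∂⁺ r (𝒜 ᶜ))
  -- Radius 0 is impossible: every `sqrtApprox` is at least 1, so the product with ε eventually
  -- stays above `P.gap`.
  mixed-measure-bound 3≤n zero ε√n≤0 _ _ _ = ε√n≤0 (record
    { gap = P.gap ; gap>0 = P.gap>0 ; from = P.from
    ; separated = λ i h → subst₂ ℚ._≤_
        (trans (ℚₚ.*-identityʳ P.gap) (sym (ℚₚ.+-identityˡ P.gap))) refl
        (*-mono-≤ (ℚₚ.<⇒≤ P.gap>0) (e-gap i h) (ℚₚ.<⇒≤ Auxiliary.0<1) (1≤sqrtApprox n i 1≤n)) })
  -- A violation carries a rational gap; at a single index `i` past all starting indices it
  -- contradicts `bound≤z`.
  mixed-measure-bound 3≤n r@(suc r′) ε√n≤r r-1<ε√n {y} seq-y violated = ℚₚ.<-irrefl refl (begin-strict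
    z            ≡⟨ ℚₚ.+-identityʳ z ⟨
    z ℚ.+ 0ℚ     <⟨ ℚₚ.+-monoʳ-< z V.gap>0 ⟩
    z ℚ.+ V.gap  ≤⟨ V.separated i (m⊔n≤o⇒n≤o i₃ V.from ℕₚ.≤-refl) ⟩
    seq y i      ≡⟨ seq-y i ⟩
    _            ≤⟨ bound≤z {ι n} {ι r} {e i} {sqrtApprox n i} {m} {z}
                      (ι-mono {1} {r} (ℕ.s≤s ℕ.z≤n)) (ι-nonNeg n) (ℚₚ.<⇒≤ 0<ei) ei≤1 (0≤s i)
                      (bounded i (m⊔n≤o⇒n≤o i₂ N h₃))
                      (≤4sqrtApprox² n i 1≤n) (ℚₚ.<⇒≤ 0<m)
                      (Separation.mixed-density 𝒜 r (ℕ.s≤s ℕ.z≤n) (small-radius (m/n*n≡m 2∣n) 3≤n r′²<n))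
                      (leftSum≥¾ i (4≤⁻¹ (*-pos 0<ei 0<m) em≤¼)) ⟩
    z            ∎)
    where
    open ℚₚ.≤-Reasoning
    module V = _<_ violated
    module W = _<_ r-1<ε√n
    z = ratio (card (∂⁺ r 𝒜 ∩ ∂⁺ r (𝒜 ᶜ))) (n C (n / 2 ℕ.+ r))
    N = proj₁ (≤-eventually {ε * √ n} ε√n≤r)
    bounded = proj₂ (≤-eventually {ε * √ n} ε√n≤r)
    i₁ = P.from ⊔ U.from
    i₂ = i₁ ⊔ W.from
    i₃ = i₂ ⊔ N
    i = i₃ ⊔ V.from
    h₃ : i₃ ℕ.≤ i
    h₃ = m⊔n≤o⇒m≤o i₃ V.from ℕₚ.≤-refl
    h₂ : i₂ ℕ.≤ i
    h₂ = m⊔n≤o⇒m≤o i₂ N h₃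
    h₁ : i₁ ℕ.≤ i
    h₁ = m⊔n≤o⇒m≤o i₁ W.from h₂
    0<ei : 0ℚ ℚ.< e i
    0<ei = 0<e i (m⊔n≤o⇒m≤o P.from U.from h₁)
    ei≤1 : e i ℚ.≤ 1ℚ
    ei≤1 = e≤1 i (m⊔n≤o⇒n≤o P.from U.from h₁)
    em≤¼ : e i ℚ.* m ℚ.≤ ½ ℚ.* ½
    em≤¼ = ℚₚ.≤-trans (*ʳ-mono m (ℚₚ.<⇒≤ 0<m) ei≤1)
      (ℚₚ.≤-trans (ℚₚ.≤-reflexive (ℚₚ.*-identityˡ m)) (q[1-q]≤¼ q))
    r′²<n : r′ ℕ.* r′ ℕ.< n
    r′²<n = radius-bound {r′} W.gap>0 ei≤1 (0≤s i) (sqrtApprox²≤ n i 1≤n)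
      (W.separated i (m⊔n≤o⇒n≤o i₁ W.from h₂))

theorem1 : Σ[ C ∈ ℝ ] Σ[ c ∈ ℝ ] (0ℝ < C) × (0ℝ < c) ×
    ((ε : ℝ) → {{_ : 0ℝ < ε}} → {{_ : ε < 1ℝ}} →
    (n : ℕ) → .{{_ : NonZero n}} → 2 ∣ n →
    (𝒜 : Family n (n / 2)) → {{_ : Proper 𝒜}} →
    (C ÷ (ε * ε)) * (log (1/ ε) + log (1/ (μ 𝒜 * (1ℝ - μ 𝒜)))) ≤ fromℕ n →
    (r : ℕ) → IsCeiling (ε * √ n) (+ r) →
    c * ((ε * ε) ÷ log (1/ (ε * (μ 𝒜 * (1ℝ - μ 𝒜))))) * (μ 𝒜 * (1ℝ - μ 𝒜))
    ≤ μ (∂⁺ r 𝒜 ∩ ∂⁺ r (𝒜 ᶜ)))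
-- The first constant is the factor in `threshold≥3`, the second the one in `bound≤z`.
theorem1 = fromℚ (ι 4) , fromℚ (+ 3 ℚ./ 68)
  , fromℚ-positive (ι-pos {4} (ℕ.s≤s ℕ.z≤n)) , fromℚ-positive (ℚₚ.positive⁻¹ (+ 3 ℚ./ 68))
  -- Each `λ _ → refl` holds because the approximants of the real expressions in the statement
  -- compute to the rational formulas.
  , λ ε n 2∣n 𝒜 large r (ε√n≤r , r-1<ε√n) → mixed-measure-bound ε n 2∣n 𝒜
      (threshold⇒3≤n ε n 2∣n 𝒜 large (λ _ → refl)) r ε√n≤r r-1<ε√n (λ _ → refl)
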